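{- Let $k\ge 1$ be an integer. (a) For every $n$ with $3\le n\le\infty$ (that is, $n\geq 3$ an integer or $n=\infty$), the digraph $\mathbb{Z}(\Theta_n,k)$ is sharply $k$-arc-transitive. (b) Let $\Delta$ be a connected stable digraph with vertex set $V$. Assume that whenever $(v,w)$ is an arc in $\Delta$ then $(w,v)$ is also an arc in $\Delta$. If $\mathrm{CDHC}(\Delta)$ is arc-transitive, then $\mathbb{Z}(\Delta,k)$ is sharply $k$-arc-transitive.
   Context: A digraph $\Gamma$ is a pair $(\mathrm V\Gamma,\mathrm E\Gamma)$ with $\mathrm E\Gamma\subseteq \mathrm V\Gamma\times \mathrm V\Gamma$ the set of arcs (loops are allowed, both $(v,w)$ and $(w,v)$ may be arcs, and $\mathrm V\Gamma$ may be infinite). A digraph is connected if its underlying undirected graph is connected. An automorphism of $\Gamma$ is a bijection of $\mathrm V\Gamma$ that preserves arcs and non-arcs. A $k$-arc is a sequence $(v_0,\dots,v_k)$ of vertices with $(v_{i-1},v_i)$ an arc for $1\le i\le k$. $\Gamma$ is $k$-arc-transitive if $\mathrm{Aut}(\Gamma)$ acts transitively on the set of $k$-arcs; arc-transitive means $1$-arc-transitive; sharply $k$-arc-transitive means $k$-arc-transitive but not $(k+1)$-arc-transitive. For a digraph $\Delta$ with vertex set $V$ and a positive integer $k$, $\mathbb{Z}(\Delta,k)$ is the digraph with vertex set $\mathbb{Z}\times V^k$ in which the out-neighbours of $(i;v_0,\dots,v_{k-1})$ are the vertices $(i+1;w_0,\dots,w_{k-1})$ such that $v_j=w_j$ if $j\not\equiv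 i \pmod k$, and $(v_j,w_j)\in \mathrm E\Delta$ if $j\equiv i\pmod k$. The canonical double half-cover $\mathrm{CDHC}(\Delta)$ is the digraph with vertex set $V\times\{0,1\}$ whose arcs are exactly the pairs $((x,0),(y,1))$ with $(x,y)\in \mathrm E\Delta$. A digraph $\Delta$ is stable if for each $x\in \mathrm V\Delta$ the pair $\{(x,0),(x,1)\}$ is a block of imprimitivity of $\mathrm{Aut}(\mathrm{CDHC}(\Delta))$, where a set $A$ is a block of imprimitivity for a group $G$ if for every $g\in G$ either $A^g=A$ or $A\cap A^g=\emptyset$. For an integer $n\geq 3$, $\Theta_n$ is the directed cycle of length $n$ with a loop attached at every vertex (vertex set $\mathbb{Z}_n$, arcs $(x,x)$ and $(x,x+1)$). $\Theta_\infty$ is the infinite directed line with a loop attached at every vertex (vertex set $\mathbb{Z}$, arcs $(x,x)$ and $(x,x+1)$).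
   Formalization: In (b), failure of (k+1)-arc-transitivity is claimed only if some vertex of Δ has two distinct out-neighbours; otherwise Δ is empty, one vertex with or without a loop, or one undirected edge, and the claim is false (one looped vertex gives a directed line). k-arc-transitivity is kept for all Δ. -}

module Defs where

open import Level using (Level; _⊔_; 0ℓ) renaming (suc to lsuc)
open import Data.Fin.Base using (Fin; inject₁; toℕ) renaming (suc to fsuc)
open import Data.Fin.Patterns using (0F; 1F)
open import Data.Integer.Base using (ℤ; +_; _+_; _-_; 1ℤ)
open import Data.Integer.Divisibility using (_∣_)
open import Data.Nat.Base using (ℕ; suc)
open import Data.Product.Base using (Σ-syntax; ∃-syntax; _×_; _,_)
open import Data.Sum.Base using (_⊎_)
open import Data.Vec.Base using (Vec; lookup)
open import Function.Bundles using (_↔_; _⇔_; module Inverse)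
open import Relation.Binary.Construct.Closure.Equivalence using (EqClosure)
open import Relation.Binary.Core using (Rel)
open import Relation.Binary.PropositionalEquality using (_≡_; _≢_)
open import Relation.Nullary using (¬_)
open import Relation.Unary using (Pred; _≐_; _∩_; _∪_; ｛_｝; Empty)

private
  variable
    v e p : Level

record Digraph (v e : Level) : Set (lsuc (v ⊔ e)) where
  field
    Vertex : Set v
    Edge   : Rel Vertex e

open Digraph public

Connected : Digraph v e → Set (v ⊔ e)
Connected Γ = ∀ x y → EqClosure (Edge Γ) x y

record Automorphism (Γ : Digraph v e) : Set (v ⊔ e) where
  field
    bijection : Vertex Γ ↔ Vertex Γ

  open Inverse bijection public using (to; from)

  field
    preserves : ∀ x y → Edge Γ x y ⇔ Edge Γ (to x) (to y)

open Automorphism public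

record Arc (k : ℕ) (Γ : Digraph v e) : Set (v ⊔ e) where
  field
    vertex : Fin (suc k) → Vertex Γ
    edge   : ∀ (i : Fin k) → Edge Γ (vertex (inject₁ i)) (vertex (fsuc i))

open Arc public

-- The proofs that consecutive vertices are adjacent are not compared: a k-arc
-- is determined by its sequence of vertices.
ArcTransitive : ℕ → Digraph v e → Set (v ⊔ e)
ArcTransitive k Γ =
  ∀ (a b : Arc k Γ) → Σ[ g ∈ Automorphism Γ ] (∀ i → to g (vertex a i) ≡ vertex b i)

SharplyArcTransitive : ℕ → Digraph v e → Set (v ⊔ e)
SharplyArcTransitive k Γ = ArcTransitive k Γ × ¬ ArcTransitive (suc k) Γ

infix 4 _≈_[mod_]

_≈_[mod_] : ℤ → ℤ → ℕ → Set
i ≈ j [mod n ] = + n ∣ i - j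

ℤDigraph : Digraph v e → ℕ → Digraph v (v ⊔ e)
ℤDigraph Δ k .Vertex = ℤ × Vec (Vertex Δ) k
ℤDigraph Δ k .Edge (i , vs) (i′ , ws) =
  i′ ≡ i + 1ℤ ×
  (∀ (j : Fin k) →
    (¬ (+ toℕ j ≈ i [mod k ]) → lookup vs j ≡ lookup ws j) ×
    (+ toℕ j ≈ i [mod k ] → Edge Δ (lookup vs j) (lookup ws j)))

CDHC : Digraph v e → Digraph v e
CDHC Δ .Vertex = Vertex Δ × Fin 2
CDHC Δ .Edge (x , s) (y , t) = s ≡ 0F × t ≡ 1F × Edge Δ x y

_^_ : {Γ : Digraph v e} → Pred (Vertex Γ) p → Automorphism Γ → Pred (Vertex Γ) (v ⊔ p)
(A ^ g) y = ∃[ x ] A x × to g x ≡ y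

IsBlock : (Γ : Digraph v e) → Pred (Vertex Γ) p → Set (v ⊔ e ⊔ p)
IsBlock Γ A = ∀ (g : Automorphism Γ) → (A ^ g) ≐ A ⊎ Empty (A ∩ (A ^ g))

Stable : Digraph v e → Set (v ⊔ e)
Stable Δ = ∀ (x : Vertex Δ) → IsBlock (CDHC Δ) (｛ x , 0F ｝ ∪ ｛ x , 1F ｝)

Θ : ℕ → Digraph 0ℓ 0ℓ
Θ n .Vertex   = Fin n
Θ n .Edge x y = y ≡ x ⊎ + toℕ y ≈ + toℕ x + 1ℤ [mod n ]

Θ∞ : Digraph 0ℓ 0ℓ
Θ∞ .Vertex   = ℤ
Θ∞ .Edge x y = y ≡ x ⊎ y ≡ x + 1ℤ

-- Some vertex has two distinct out-neighbours.  A connected digraph with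
-- symmetric edge relation fails this (classically) only if it is empty, a
-- single vertex with or without a loop, or a single undirected edge without
-- loops.  For those Δ, ℤ(Δ,k) has no arcs or is a disjoint union of two-way
-- infinite directed lines, so it is s-arc-transitive for every s ≥ 1.
Branching : Digraph v e → Set (v ⊔ e)
Branching Δ = ∃[ x ] ∃[ y ] ∃[ z ] Edge Δ x y × Edge Δ x z × y ≢ z

{-# OPTIONS --safe #-}
module Submission where

-- Along a k-arc of ℤ(Δ,k) every coordinate moves exactly once.  Call a sequence
-- of permutations (g t), t ∈ ℤ, a twist if each pair (g t, g (t + 1)) is an
-- automorphism of CDHC(Δ); letting g t act on a coordinate that has moved t times
-- gives an automorphism of ℤ(Δ,k), independently in each coordinate.  Hence
-- ℤ(Δ,k) is k-arc-transitive as soon as any arc of Δ goes to any other under a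
-- twist.  For Θ n there are the rotations, and the reflections x ↦ c + t − x,
-- which exchange the two kinds of arcs; for symmetric Δ an automorphism (a, b) of
-- CDHC(Δ) yields the twist …, a, b, a, b, ….
--
-- For the failure of (k+1)-arc-transitivity take two (k+1)-arcs that differ only in
-- the last vertex: coordinate 0 goes along y → x → y, respectively y → x → z.  An
-- automorphism φ that maps one to the other fixes the first k+1 vertices.  On the
-- copy of CDHC(Δ) between levels 0 and 1 through the initial vertex, φ fixes (y,0),
-- hence (y,1) by stability.  Coordinate 0 rests until level k, so in the copy of
-- CDHC(Δ) between levels k and k+1 the vertex (y,0) is fixed again, hence (y,1), the
-- last vertex of the first arc: a contradiction.  This needs CDHC(Δ) connected,
-- that is, Δ not bipartite; a bipartite Δ is excluded because CDHC(Δ) then has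
-- automorphisms acting on one half only.  For Θ n the same argument works with
-- stability replaced by uniqueness of common neighbours.

open import Defs
open import Algebra.Properties.AbelianGroup using (∙-cancelʳ)
open import Data.Bool.Base using (true; false; if_then_else_)
open import Data.Empty using (⊥-elim)
open import Data.Fin.Base using (Fin; toℕ; fromℕ<; inject₁; opposite; zero; suc)
open import Data.Fin.Patterns using (0F; 1F)
open import Data.Fin.Properties
  using (_≟_; toℕ-fromℕ<; toℕ-injective; toℕ<n; toℕ-inject₁; opposite-involutive)
open import Data.Integer.Base using (ℤ; +_; -[1+_]; _+_; _-_; -_; _*_; 0ℤ; 1ℤ; ∣_∣)
open import Data.Integer.DivMod using (_%ℕ_; _/ℕ_; n%ℕd<d; a≡a%ℕn+[a/ℕn]*n)
import Data.Integer.Divisibility as Unsigned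
open import Data.Integer.Divisibility.Signed as Signed
  using (divides; ∣ᵤ⇒∣; ∣⇒∣ᵤ; ∣m∣n⇒∣m+n; ∣m⇒∣-m)
import Data.Integer.Properties as ℤ
open import Data.Integer.Tactic.RingSolver using (solve-∀)
open import Data.Nat.Base as ℕ using (ℕ; _≥_; NonZero; s≤s; z≤n; _<ᵇ_)
import Data.Nat.Divisibility as ℕ
import Data.Nat.Properties as ℕ
open import Data.Product.Base using (_×_; _,_; ∃-syntax; Σ-syntax; proj₁; proj₂)
open import Data.Sum.Base using (_⊎_; inj₁; inj₂; [_,_]′)
open import Data.Vec.Base using (Vec; lookup; tabulate; _∷_; head)
open import Data.Vec.Properties using (lookup∘tabulate; tabulate∘lookup; tabulate-cong; ∷-injectiveˡ)
open import Function.Base using (_∘_)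
open import Function.Bundles using (mk↔ₛ′; mk⇔; module Inverse; module Equivalence)
open import Level using (Level; _⊔_)
open import Relation.Binary.Construct.Closure.Equivalence using (EqClosure)
open import Relation.Binary.Construct.Closure.ReflexiveTransitive using (ε; _◅_)
open import Relation.Binary.Construct.Closure.Symmetric using (fwd; bwd)
open import Relation.Binary.Definitions using (Symmetric)
open import Relation.Binary.PropositionalEquality
open import Relation.Nullary using (Dec; yes; no; ¬_; does)
open import Relation.Nullary.Decidable using (dec-true; dec-false)
open import Relation.Unary using (Pred; _∪_; ｛_｝)

private
  variable
    v e : Level

-- Congruences

-- Since _≈_[mod_] unfolds to a divisibility of absolute values, its integer
-- arguments cannot be inferred and are explicit below.

≡⇒≈ : ∀ n {i j} → i ≡ j → i ≈ j [mod n ]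
≡⇒≈ n {i} refl = ∣⇒∣ᵤ {+ n} (divides 0ℤ (ℤ.+-inverseʳ i))

≈-resp : ∀ n i j i′ j′ → i - j ≡ i′ - j′ → i ≈ j [mod n ] → i′ ≈ j′ [mod n ]
≈-resp n i j i′ j′ eq = subst (+ n Unsigned.∣_) eq

≈-sym : ∀ n i j → i ≈ j [mod n ] → j ≈ i [mod n ]
≈-sym n i j p = ≈-resp n (- i) (- j) j i (lemma i j)
  (∣⇒∣ᵤ {+ n} (subst (+ n Signed.∣_) (lemma′ i j) (∣m⇒∣-m {+ n} {i - j} (∣ᵤ⇒∣ {+ n} {i - j} p))))
  where
  lemma : ∀ i j → - i - - j ≡ j - i
  lemma = solve-∀
  lemma′ : ∀ i j → - (i - j) ≡ - i - - j
  lemma′ = solve-∀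

-- Congruences are added, and the ring identity that matches the sum of the differences with the
-- goal is left to the solver. This form covers transitivity and its shifted variants at once.
≈-combine : ∀ n i j i′ j′ l m → (i - j) + (i′ - j′) ≡ l - m →
            i ≈ j [mod n ] → i′ ≈ j′ [mod n ] → l ≈ m [mod n ]
≈-combine n i j i′ j′ l m eq p q =
  ∣⇒∣ᵤ {+ n} (subst (+ n Signed.∣_) eq (∣m∣n⇒∣m+n (∣ᵤ⇒∣ {+ n} {i - j} p) (∣ᵤ⇒∣ {+ n} {i′ - j′} q)))

≈-trans : ∀ n i j l → i ≈ j [mod n ] → j ≈ l [mod n ] → i ≈ l [mod n ]
≈-trans n i j l = ≈-combine n i j j l i l (lemma i j l)
  where
  lemma : ∀ i j l → (i - j) + (j - l) ≡ i - l
  lemma = solve-∀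

≈-dec : ∀ n i j → Dec (i ≈ j [mod n ])
≈-dec n i j = n ℕ.∣? ∣ i - j ∣

≈0⇒≡ : ∀ i j → i ≈ j [mod 0 ] → i ≡ j
≈0⇒≡ i j p = ℤ.i-j≡0⇒i≡j i j (ℤ.∣i∣≡0⇒i≡0 (ℕ.0∣⇒≡0 p))

<∧≈0⇒≡0 : ∀ n i → ∣ i ∣ ℕ.< n → i ≈ 0ℤ [mod n ] → i ≡ 0ℤ
<∧≈0⇒≡0 n i i<n p = ℤ.∣i∣≡0⇒i≡0 (small ∣ i ∣ i<n (subst (λ z → n ℕ.∣ ∣ z ∣) (ℤ.+-identityʳ i) p))
  where
  small : ∀ m → m ℕ.< n → n ℕ.∣ m → m ≡ 0
  small ℕ.zero    m<n n∣m = refl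
  small (ℕ.suc m) m<n n∣m = ⊥-elim (ℕ.<⇒≱ m<n (ℕ.∣⇒≤ n∣m))

-- A labelled set of representatives for ℤ modulo n, where n = 0 is allowed and
-- stands for ℤ itself.
record Residues (n : ℕ) {a : Level} (V : Set a) : Set a where
  field
    label           : V → ℤ
    at              : ℤ → V
    label-at        : ∀ z → label (at z) ≈ z [mod n ]
    label-injective : ∀ u v → label u ≈ label v [mod n ] → u ≡ v

  at-≡ : ∀ i v → i ≈ label v [mod n ] → at i ≡ v
  at-≡ i v p = label-injective (at i) v (≈-trans n (label (at i)) i (label v) (label-at i) p)

  at-injective : ∀ i j → at i ≡ at j → i ≈ j [mod n ]
  at-injective i j eq = ≈-trans n i (label (at i)) j
    (≈-sym n (label (at i)) i (label-at i))
    (subst (λ v → label v ≈ j [mod n ]) (sym eq) (label-at j))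

open Residues

Fin-residues : ∀ n .{{_ : NonZero n}} → Residues n (Fin n)
Fin-residues n .label j    = + toℕ j
Fin-residues n .at z       = fromℕ< (n%ℕd<d z n)
Fin-residues n .label-at z = ∣⇒∣ᵤ {+ n} (divides (- (z /ℕ n)) (begin
  + toℕ (fromℕ< (n%ℕd<d z n)) - z              ≡⟨ cong (λ m → + m - z) (toℕ-fromℕ< (n%ℕd<d z n)) ⟩
  + (z %ℕ n) - z                               ≡⟨ cong (_-_ (+ (z %ℕ n))) (a≡a%ℕn+[a/ℕn]*n z n) ⟩
  + (z %ℕ n) - (+ (z %ℕ n) + (z /ℕ n) * + n)   ≡⟨ lemma (+ (z %ℕ n)) (z /ℕ n) (+ n) ⟩
  - (z /ℕ n) * + n                             ∎))
  where
  open ≡-Reasoning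
  lemma : ∀ r q n → r - (r + q * n) ≡ - q * n
  lemma = solve-∀
Fin-residues n .label-injective u v p =
  toℕ-injective (ℤ.+-injective (ℤ.i-j≡0⇒i≡j (+ toℕ u) (+ toℕ v) (<∧≈0⇒≡0 n (+ toℕ u - + toℕ v) bound
    (≈-resp n (+ toℕ u) (+ toℕ v) (+ toℕ u - + toℕ v) 0ℤ (sym (ℤ.+-identityʳ _)) p))))
  where
  bound : ∣ + toℕ u - + toℕ v ∣ ℕ.< n
  bound rewrite ℤ.[+m]-[+n]≡m⊖n (toℕ u) (toℕ v) =
    ℕ.≤-<-trans (ℤ.∣m⊝n∣≤m⊔n (toℕ u) (toℕ v)) (ℕ.⊔-pres-<m (toℕ<n u) (toℕ<n v))

ℤ-residues : Residues 0 ℤ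
ℤ-residues .label z                = z
ℤ-residues .at z                   = z
ℤ-residues .label-at z             = ≡⇒≈ 0 {z} refl
ℤ-residues .label-injective u v p  = ≈0⇒≡ u v p

-- Two-sided recursion over ℤ

module _ {a} {A : Set a} (up down : ℤ → A → A) (up-down : ∀ l x → up l (down l x) ≡ x) (start : A) where

  ℤ-rec : ℤ → A
  ℤ-rec (+ ℕ.zero)       = start
  ℤ-rec (+ ℕ.suc n)      = up (+ n) (ℤ-rec (+ n))
  ℤ-rec -[1+ ℕ.zero ]    = down -[1+ 0 ] start
  ℤ-rec -[1+ ℕ.suc n ]   = down -[1+ ℕ.suc n ] (ℤ-rec -[1+ n ])

  -- At a negative `l` the value is `down l` applied to the value at `l + 1`, so there the equation
  -- is `up-down`.
  ℤ-rec-step : ∀ l → ℤ-rec (l + 1ℤ) ≡ up l (ℤ-rec l)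
  ℤ-rec-step (+ n) rewrite ℕ.+-comm n 1 = refl
  ℤ-rec-step -[1+ ℕ.zero ]  = sym (up-down _ _)
  ℤ-rec-step -[1+ ℕ.suc n ] = sym (up-down _ _)

-- Automorphisms

lookup-injective : ∀ {a n} {A : Set a} {xs ys : Vec A n} → (∀ j → lookup xs j ≡ lookup ys j) → xs ≡ ys
lookup-injective {xs = xs} {ys} p =
  trans (sym (tabulate∘lookup xs)) (trans (tabulate-cong p) (tabulate∘lookup ys))

module _ {Γ : Digraph v e} where

  -- Non-arcs are preserved because the inverse map preserves arcs.
  mkAutomorphism : (f g : Vertex Γ → Vertex Γ) → (∀ x → f (g x) ≡ x) → (∀ x → g (f x) ≡ x) →
                   (∀ x y → Edge Γ x y → Edge Γ (f x) (f y)) →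
                   (∀ x y → Edge Γ x y → Edge Γ (g x) (g y)) → Automorphism Γ
  mkAutomorphism f g f∘g g∘f f-edge g-edge = record
    { bijection = mk↔ₛ′ f g f∘g g∘f
    ; preserves = λ x y → mk⇔ (f-edge x y)
        (λ fx→fy → subst₂ (Edge Γ) (g∘f x) (g∘f y) (g-edge (f x) (f y) fx→fy))
    }

  module _ (g : Automorphism Γ) where

    to∘from : ∀ x → to g (from g x) ≡ x
    to∘from = Inverse.strictlyInverseˡ (bijection g)

    from∘to : ∀ x → from g (to g x) ≡ x
    from∘to = Inverse.strictlyInverseʳ (bijection g)

    to-injective : ∀ {x y} → to g x ≡ to g y → x ≡ y
    to-injective {x} {y} eq = trans (sym (from∘to x)) (trans (cong (from g) eq) (from∘to y))

    to-edge : ∀ {x y} → Edge Γ x y → Edge Γ (to g x) (to g y)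
    to-edge {x} {y} = Equivalence.to (preserves g x y)

    to-edge⁻¹ : ∀ {x y} → Edge Γ (to g x) (to g y) → Edge Γ x y
    to-edge⁻¹ {x} {y} = Equivalence.from (preserves g x y)

    from-edge : ∀ {x y} → Edge Γ x y → Edge Γ (from g x) (from g y)
    from-edge {x} {y} x→y = to-edge⁻¹ (subst₂ (Edge Γ) (sym (to∘from x)) (sym (to∘from y)) x→y)

  inverse : Automorphism Γ → Automorphism Γ
  inverse g = mkAutomorphism (from g) (to g) (from∘to g) (to∘from g)
    (λ _ _ → from-edge g) (λ _ _ → to-edge g)

  compose : Automorphism Γ → Automorphism Γ → Automorphism Γ
  compose g h = mkAutomorphism (to g ∘ to h) (from h ∘ from g)
    (λ x → trans (cong (to g) (to∘from h (from g x))) (to∘from g x))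
    (λ x → trans (cong (from h) (from∘to g (to h x))) (from∘to h x))
    (λ _ _ → to-edge g ∘ to-edge h)
    (λ _ _ → from-edge h ∘ from-edge g)

  mapArc : ∀ {k} → Automorphism Γ → Arc k Γ → Arc k Γ
  mapArc g a .vertex = to g ∘ vertex a
  mapArc g a .edge   = to-edge g ∘ edge a

-- Twists

record Twist (Δ : Digraph v e) : Set (v ⊔ e) where
  field
    act          : ℤ → Vertex Δ → Vertex Δ
    unact        : ℤ → Vertex Δ → Vertex Δ
    act∘unact    : ∀ t x → act t (unact t x) ≡ x
    unact∘act    : ∀ t x → unact t (act t x) ≡ x
    act-edge     : ∀ t {x y} → Edge Δ x y → Edge Δ (act t x) (act (t + 1ℤ) y)
    unact-edge   : ∀ t {x y} → Edge Δ x y → Edge Δ (unact t x) (unact (t + 1ℤ) y)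

open Twist

invertTwist : {Δ : Digraph v e} → Twist Δ → Twist Δ
invertTwist g = record
  { act        = unact g
  ; unact      = act g
  ; act∘unact  = unact∘act g
  ; unact∘act  = act∘unact g
  ; act-edge   = unact-edge g
  ; unact-edge = act-edge g
  }

-- Times 0 and 1 are the numbers of moves that a coordinate has made before and after its single
-- move along a k-arc.
TwistTransitive : Digraph v e → Set (v ⊔ e)
TwistTransitive Δ = ∀ {x y x′ y′} → Edge Δ x y → Edge Δ x′ y′ →
  Σ[ g ∈ Twist Δ ] act g 0ℤ x ≡ x′ × act g 1ℤ y ≡ y′

-- The sequence can change only between `inject₁ r` and `suc r`, so it is constant on either side.
-- It is applied to one coordinate along a k-arc.
one-jump : ∀ {a n} {A : Set a} (f : Fin (ℕ.suc n) → A) (r : Fin n) →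
           (∀ i → i ≢ r → f (inject₁ i) ≡ f (suc i)) →
           f (inject₁ r) ≡ f zero × (∀ m → f m ≡ f zero ⊎ f m ≡ f (suc r))
one-jump {n = ℕ.suc n} f zero steady = refl , after
  where
  constant : ∀ {n} (h : Fin (ℕ.suc n) → _) → (∀ i → h (inject₁ i) ≡ h (suc i)) → ∀ m → h m ≡ h zero
  constant             h eq zero    = refl
  constant {ℕ.suc n}   h eq (suc m) = trans (constant (h ∘ suc) (eq ∘ suc) m) (sym (eq zero))
  after : ∀ m → f m ≡ f zero ⊎ f m ≡ f (suc zero)
  after zero    = inj₁ refl
  after (suc m) = inj₂ (constant (f ∘ suc) (λ i → steady (suc i) (λ ())) m)
one-jump {n = ℕ.suc n} f (suc r) steady with one-jump (f ∘ suc) r (λ i i≢r → steady (suc i) (λ { refl → i≢r refl }))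
... | before , cases = trans before (sym first) , split
  where
  first : f zero ≡ f (suc zero)
  first = steady zero (λ ())
  split : ∀ m → f m ≡ f zero ⊎ f m ≡ f (suc (suc r))
  split zero = inj₁ refl
  split (suc m) with cases m
  ... | inj₁ p = inj₁ (trans p (sym first))
  ... | inj₂ p = inj₂ p

levels : ∀ {n} (ℓ : Fin (ℕ.suc n) → ℤ) → (∀ i → ℓ (suc i) ≡ ℓ (inject₁ i) + 1ℤ) →
         ∀ m → ℓ m ≡ ℓ zero + + toℕ m
levels           ℓ next zero    = sym (ℤ.+-identityʳ (ℓ zero))
levels {ℕ.suc n} ℓ next (suc m) = begin
  ℓ (suc m)                     ≡⟨ levels (ℓ ∘ suc) (next ∘ suc) m ⟩
  ℓ (suc zero) + + toℕ m        ≡⟨ cong (_+ + toℕ m) (next zero) ⟩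
  ℓ zero + 1ℤ + + toℕ m         ≡⟨ ℤ.+-assoc (ℓ zero) 1ℤ (+ toℕ m) ⟩
  ℓ zero + + toℕ (suc m)        ∎
  where open ≡-Reasoning

-- Translations of ℤ(Δ,k)

module _ (Δ : Digraph v e) (k : ℕ) .{{_ : NonZero k}} where

  private
    module F = Residues (Fin-residues k)

    rotate : ℤ → Fin k → Fin k
    rotate c j = F.at (F.label j + c)

    rotate-inverse : ∀ c d → c + d ≡ 0ℤ → ∀ j → rotate c (rotate d j) ≡ j
    rotate-inverse c d c+d≡0 j = F.label-injective (rotate c (rotate d j)) j
      (≈-combine k (F.label (rotate c (rotate d j))) (F.label (rotate d j) + c) (F.label (rotate d j)) (F.label j + d)
        (F.label (rotate c (rotate d j))) (F.label j)
        (trans (lemma (F.label (rotate c (rotate d j))) (F.label (rotate d j)) (F.label j) c d)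
          (trans (cong (λ z → F.label (rotate c (rotate d j)) - F.label j - z) c+d≡0) (ℤ.+-identityʳ _)))
        (F.label-at (F.label (rotate d j) + c)) (F.label-at (F.label j + d)))
      where
      lemma : ∀ x y j c d → (x - (y + c)) + (y - (j + d)) ≡ x - j - (c + d)
      lemma = solve-∀

    rotate-≈ : ∀ d j l → F.label j ≈ l + d [mod k ] → F.label (rotate (- d) j) ≈ l [mod k ]
    rotate-≈ d j l = ≈-combine k (F.label (rotate (- d) j)) (F.label j + - d) (F.label j) (l + d)
      (F.label (rotate (- d) j)) l
      (lemma (F.label (rotate (- d) j)) (F.label j) d l) (F.label-at (F.label j + - d))
      where
      lemma : ∀ y j d l → (y - (j + - d)) + (j - (l + d)) ≡ y - l
      lemma = solve-∀

    rotate-≈⁻¹ : ∀ d j l → F.label (rotate (- d) j) ≈ l [mod k ] → F.label j ≈ l + d [mod k ]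
    rotate-≈⁻¹ d j l = ≈-combine k (F.label j + - d) (F.label (rotate (- d) j)) (F.label (rotate (- d) j)) l
      (F.label j) (l + d)
      (lemma (F.label (rotate (- d) j)) (F.label j) d l)
      (≈-sym k (F.label (rotate (- d) j)) (F.label j + - d) (F.label-at (F.label j + - d)))
      where
      lemma : ∀ y j d l → (j + - d - y) + (y - l) ≡ j - (l + d)
      lemma = solve-∀

    -- The coordinate that moves out of level `l` has index congruent to `l`, so a shift of the
    -- levels by `d` has to rotate the coordinates by `d` as well.
    translate : ℤ → Vertex (ℤDigraph Δ k) → Vertex (ℤDigraph Δ k)
    translate d (l , xs) = l + d , tabulate (λ j → lookup xs (rotate (- d) j))

    translate-inverse : ∀ d e → d + e ≡ 0ℤ → ∀ x → translate d (translate e x) ≡ x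
    translate-inverse d e d+e≡0 (l , xs) = cong₂ _,_
      (trans (ℤ.+-assoc l e d) (trans (cong (_+_ l) (trans (ℤ.+-comm e d) d+e≡0)) (ℤ.+-identityʳ l)))
      (lookup-injective λ j → trans (lookup∘tabulate _ j) (trans (lookup∘tabulate _ (rotate (- d) j))
        (cong (lookup xs) (rotate-inverse (- e) (- d)
          (trans (lemma d e) (cong -_ d+e≡0)) j))))
      where
      lemma : ∀ d e → - e + - d ≡ - (d + e)
      lemma = solve-∀

    translate-edge : ∀ d x y → Edge (ℤDigraph Δ k) x y → Edge (ℤDigraph Δ k) (translate d x) (translate d y)
    translate-edge d (l , xs) (l′ , ys) (l′≡l+1 , coord) =
      trans (cong (_+ d) l′≡l+1) (lemma l d) , λ j →
        (λ j≉ → trans (lookup∘tabulate _ j)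
          (trans (proj₁ (coord (rotate (- d) j)) (λ p → j≉ (rotate-≈⁻¹ d j l p)))
            (sym (lookup∘tabulate _ j)))) ,
        (λ j≈ → subst₂ (Edge Δ) (sym (lookup∘tabulate _ j)) (sym (lookup∘tabulate _ j))
          (proj₂ (coord (rotate (- d) j)) (rotate-≈ d j l j≈)))
      where
      lemma : ∀ l d → l + 1ℤ + d ≡ l + d + 1ℤ
      lemma = solve-∀

  translation : ℤ → Automorphism (ℤDigraph Δ k)
  translation d = mkAutomorphism (translate d) (translate (- d))
    (translate-inverse d (- d) (ℤ.+-inverseʳ d)) (translate-inverse (- d) d (ℤ.+-inverseˡ d))
    (translate-edge d) (translate-edge (- d))

  -- Automorphisms of ℤ(Δ,k) from twists

  private
    step : Fin k → ℤ → ℤ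
    step j l = if does (≈-dec k (+ toℕ j) l) then 1ℤ else 0ℤ

    step-move : ∀ j l → + toℕ j ≈ l [mod k ] → step j l ≡ 1ℤ
    step-move j l j≈l = cong (if_then 1ℤ else 0ℤ) (dec-true (≈-dec k (+ toℕ j) l) j≈l)

    step-rest : ∀ j l → ¬ (+ toℕ j ≈ l [mod k ]) → step j l ≡ 0ℤ
    step-rest j l j≉l = cong (if_then 1ℤ else 0ℤ) (dec-false (≈-dec k (+ toℕ j) l) j≉l)

    -+-cancel : ∀ c s → c - s + s ≡ c
    -+-cancel = solve-∀

    count₀ : Fin k → ℤ → ℤ
    count₀ j = ℤ-rec (λ l c → c + step j l) (λ l c → c - step j l) (λ l c → -+-cancel c (step j l)) 0ℤ

    count₀-step : ∀ j l → count₀ j (l + 1ℤ) ≡ count₀ j l + step j l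
    count₀-step j = ℤ-rec-step (λ l c → c + step j l) (λ l c → c - step j l) (λ l c → -+-cancel c (step j l)) 0ℤ

    +1-comm : ∀ c d → c + 1ℤ - d ≡ c - d + 1ℤ
    +1-comm = solve-∀

  -- The signed number of times that coordinate j moves between levels i and l.
  abstract
    count : ℤ → Fin k → ℤ → ℤ
    count i j l = count₀ j l - count₀ j i

    count-start : ∀ i j → count i j i ≡ 0ℤ
    count-start i j = ℤ.+-inverseʳ (count₀ j i)

    count-move : ∀ i j l → + toℕ j ≈ l [mod k ] → count i j (l + 1ℤ) ≡ count i j l + 1ℤ
    count-move i j l j≈l = trans
      (cong (_- count₀ j i) (trans (count₀-step j l) (cong (_+_ (count₀ j l)) (step-move j l j≈l))))
      (+1-comm (count₀ j l) (count₀ j i))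

    count-rest : ∀ i j l → ¬ (+ toℕ j ≈ l [mod k ]) → count i j (l + 1ℤ) ≡ count i j l
    count-rest i j l j≉l = cong (_- count₀ j i)
      (trans (count₀-step j l) (trans (cong (_+_ (count₀ j l)) (step-rest j l j≉l)) (ℤ.+-identityʳ (count₀ j l))))

  private
    twistAt : ℤ → (Fin k → Twist Δ) → Vertex (ℤDigraph Δ k) → Vertex (ℤDigraph Δ k)
    twistAt i G (l , xs) = l , tabulate (λ j → act (G j) (count i j l) (lookup xs j))

    twistAt-inverse : ∀ i G x → twistAt i G (twistAt i (invertTwist ∘ G) x) ≡ x
    twistAt-inverse i G (l , xs) = cong (l ,_) (lookup-injective λ j →
      trans (lookup∘tabulate _ j) (trans (cong (act (G j) (count i j l)) (lookup∘tabulate _ j))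
        (act∘unact (G j) (count i j l) (lookup xs j))))

    -- A resting coordinate keeps its count and hence its permutation. For a moving coordinate the
    -- count grows by one, which is the situation of `act-edge`.
    twistAt-edge : ∀ i G x y → Edge (ℤDigraph Δ k) x y → Edge (ℤDigraph Δ k) (twistAt i G x) (twistAt i G y)
    twistAt-edge i G (l , xs) (.(l + 1ℤ) , ys) (refl , coord) = refl , λ j →
      (λ j≉l → trans (lookup∘tabulate _ j)
        (trans (cong₂ (act (G j)) (sym (count-rest i j l j≉l)) (proj₁ (coord j) j≉l))
          (sym (lookup∘tabulate _ j)))) ,
      (λ j≈l → subst₂ (Edge Δ) (sym (lookup∘tabulate _ j))
        (trans (cong (λ t → act (G j) t (lookup ys j)) (sym (count-move i j l j≈l))) (sym (lookup∘tabulate _ j)))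
        (act-edge (G j) (count i j l) (proj₂ (coord j) j≈l)))

  twisting : ℤ → (Fin k → Twist Δ) → Automorphism (ℤDigraph Δ k)
  twisting i G = mkAutomorphism (twistAt i G) (twistAt i (invertTwist ∘ G))
    (twistAt-inverse i G) (twistAt-inverse i (invertTwist ∘ G))
    (twistAt-edge i G) (twistAt-edge i (invertTwist ∘ G))

  -- Transitivity on k-arcs

  private
    level : ∀ {n} → Arc n (ℤDigraph Δ k) → Fin (ℕ.suc n) → ℤ
    level a m = proj₁ (vertex a m)

    coordinate : ∀ {n} → Arc n (ℤDigraph Δ k) → Fin k → Fin (ℕ.suc n) → Vertex Δ
    coordinate a j m = lookup (proj₂ (vertex a m)) j

    level-formula : ∀ {n} (a : Arc n (ℤDigraph Δ k)) m → level a m ≡ level a zero + + toℕ m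
    level-formula a = levels (level a) (λ i → proj₁ (edge a i))

    module _ (transitive : TwistTransitive Δ) (a b : Arc k (ℤDigraph Δ k))
             (start : level a zero ≡ level b zero) where

      i₀ : ℤ
      i₀ = level a zero

      level≡ : ∀ m → level a m ≡ level b m
      level≡ m = trans (level-formula a m) (trans (cong (_+ + toℕ m) start) (sym (level-formula b m)))

      module _ (j : Fin k) where

        -- Coordinate `j` moves out of level `i₀ + m` when `m` is congruent to `j - i₀`, which
        -- happens for exactly one of the `k` steps.
        time : Fin k
        time = F.at (+ toℕ j - i₀)

        level-time : ∀ m → level a (inject₁ m) ≡ i₀ + + toℕ m
        level-time m = trans (level-formula a (inject₁ m)) (cong (λ z → i₀ + + z) (toℕ-inject₁ m))

        moves : + toℕ j ≈ level a (inject₁ time) [mod k ]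
        moves = subst (λ l → + toℕ j ≈ l [mod k ]) (sym (level-time time))
          (≈-resp k (+ toℕ j - i₀) (+ toℕ time) (+ toℕ j) (i₀ + + toℕ time) (lemma (+ toℕ j) i₀ (+ toℕ time))
            (≈-sym k (+ toℕ time) (+ toℕ j - i₀) (F.label-at (+ toℕ j - i₀))))
          where
          lemma : ∀ j i t → j - i - t ≡ j - (i + t)
          lemma = solve-∀

        rests : ∀ m → m ≢ time → ¬ (+ toℕ j ≈ level a (inject₁ m) [mod k ])
        rests m m≢time p = m≢time (F.label-injective m time
          (≈-sym k (+ toℕ time) (+ toℕ m)
            (≈-combine k (+ toℕ time) (+ toℕ j - i₀) (+ toℕ j) (i₀ + + toℕ m) (+ toℕ time) (+ toℕ m)
              (lemma (+ toℕ time) (+ toℕ j) i₀ (+ toℕ m)) (F.label-at (+ toℕ j - i₀))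
              (subst (λ l → + toℕ j ≈ l [mod k ]) (level-time m) p))))
          where
          lemma : ∀ t j i m → (t - (j - i)) + (j - (i + m)) ≡ t - m
          lemma = solve-∀

        -- Both arcs run through the same levels, so the count and the two values of coordinate `j`
        -- change at the same step; as a triple they need `one-jump` only once.
        state : Fin (ℕ.suc k) → ℤ × Vertex Δ × Vertex Δ
        state m = count i₀ j (level a m) , coordinate a j m , coordinate b j m

        steady : ∀ m → m ≢ time → state (inject₁ m) ≡ state (suc m)
        steady m m≢time = cong₂ _,_
          (sym (trans (cong (count i₀ j) (proj₁ (edge a m))) (count-rest i₀ j _ (rests m m≢time))))
          (cong₂ _,_ (proj₁ (proj₂ (edge a m) j) (rests m m≢time))
            (proj₁ (proj₂ (edge b m) j) (subst (λ l → ¬ (+ toℕ j ≈ l [mod k ])) (level≡ (inject₁ m)) (rests m m≢time))))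

        before : state (inject₁ time) ≡ state zero
        before = proj₁ (one-jump state time steady)

        edge-a : Edge Δ (coordinate a j zero) (coordinate a j (suc time))
        edge-a = subst (λ x → Edge Δ x (coordinate a j (suc time))) (cong (proj₁ ∘ proj₂) before)
          (proj₂ (proj₂ (edge a time) j) moves)

        edge-b : Edge Δ (coordinate b j zero) (coordinate b j (suc time))
        edge-b = subst (λ x → Edge Δ x (coordinate b j (suc time))) (cong (proj₂ ∘ proj₂) before)
          (proj₂ (proj₂ (edge b time) j) (subst (λ l → + toℕ j ≈ l [mod k ]) (level≡ (inject₁ time)) moves))

        count-after : count i₀ j (level a (suc time)) ≡ 1ℤ
        count-after = trans (cong (count i₀ j) (proj₁ (edge a time)))
          (trans (count-move i₀ j (level a (inject₁ time)) moves)
            (cong (_+ 1ℤ) (trans (cong proj₁ before) (count-start i₀ j))))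

        Matches : Twist Δ → ℤ × Vertex Δ × Vertex Δ → Set _
        Matches g (t , x , x′) = act g t x ≡ x′

        matches : (g : Twist Δ) → act g 0ℤ (coordinate a j zero) ≡ coordinate b j zero →
                  act g 1ℤ (coordinate a j (suc time)) ≡ coordinate b j (suc time) → ∀ m → Matches g (state m)
        matches g g-before g-after m = [ from-start , from-after ]′ (proj₂ (one-jump state time steady) m)
          where
          from-start : state m ≡ state zero → Matches g (state m)
          from-start eq = subst (Matches g) (sym eq)
            (trans (cong (λ t → act g t (coordinate a j zero)) (count-start i₀ j)) g-before)
          from-after : state m ≡ state (suc time) → Matches g (state m)
          from-after eq = subst (Matches g) (sym eq)
            (trans (cong (λ t → act g t (coordinate a j (suc time))) count-after) g-after)

        matching-twist : Σ[ g ∈ Twist Δ ] (∀ m → Matches g (state m))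
        matching-twist = let (g , g-before , g-after) = transitive edge-a edge-b in
          g , matches g g-before g-after

      match : Σ[ g ∈ Automorphism (ℤDigraph Δ k) ] (∀ m → to g (vertex a m) ≡ vertex b m)
      match = twisting i₀ (proj₁ ∘ matching-twist) , λ m → cong₂ _,_ (level≡ m)
        (lookup-injective λ j → trans (lookup∘tabulate _ j) (proj₂ (matching-twist j) m))

  -- A translation brings the two arcs to a common initial level; then each coordinate is matched by
  -- a twist of its own.
  twistTransitive⇒arcTransitive : TwistTransitive Δ → ArcTransitive k (ℤDigraph Δ k)
  twistTransitive⇒arcTransitive transitive a b =
    compose (proj₁ g) (translation d) , proj₂ g
    where
    d : ℤ
    d = level b zero - level a zero
    lemma : ∀ x y → x + (y - x) ≡ y
    lemma = solve-∀
    g = match transitive (mapArc (translation d) a) b (lemma (level a zero) (level b zero))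

-- Arcs with one coordinate moving twice

<ᵇ-true : ∀ {m n} → m ℕ.< n → (m <ᵇ n) ≡ true
<ᵇ-true {ℕ.zero}  {ℕ.suc n} m<n         = refl
<ᵇ-true {ℕ.suc m} {ℕ.suc n} (s≤s m<n)   = <ᵇ-true m<n

<ᵇ-irrefl : ∀ n → (n <ᵇ n) ≡ false
<ᵇ-irrefl ℕ.zero    = refl
<ᵇ-irrefl (ℕ.suc n) = <ᵇ-irrefl n

<ᵇ-suc : ∀ m n → m ≢ n → (m <ᵇ n) ≡ (m <ᵇ ℕ.suc n)
<ᵇ-suc ℕ.zero    ℕ.zero    m≢n = ⊥-elim (m≢n refl)
<ᵇ-suc ℕ.zero    (ℕ.suc n) m≢n = refl
<ᵇ-suc (ℕ.suc m) ℕ.zero    m≢n = refl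
<ᵇ-suc (ℕ.suc m) (ℕ.suc n) m≢n = <ᵇ-suc m n (m≢n ∘ cong ℕ.suc)

+suc : ∀ m → + ℕ.suc m ≡ + m + 1ℤ
+suc m = cong +_ (ℕ.+-comm 1 m)

module _ (Δ : Digraph v e) (k-1 : ℕ) where

  private
    k : ℕ
    k = ℕ.suc k-1

  Fin-≈⇒≡ : ∀ (j : Fin k) m → m ℕ.< k → + toℕ j ≈ + m [mod k ] → toℕ j ≡ m
  Fin-≈⇒≡ j m m<k j≈m = trans (cong toℕ (Residues.label-injective (Fin-residues k) j (fromℕ< m<k)
    (subst (λ z → + toℕ j ≈ + z [mod k ]) (sym (toℕ-fromℕ< m<k)) j≈m))) (toℕ-fromℕ< m<k)

  0≈k : 0ℤ ≈ + k [mod k ]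
  0≈k = ≈-sym k (+ k) 0ℤ (subst (λ z → k ℕ.∣ ∣ z ∣) (sym (ℤ.+-identityʳ (+ k))) ℕ.∣-refl)

  -- A copy of CDHC(Δ) inside ℤ(Δ,k), in which coordinate 0 moves.
  module Line (i i′ : ℤ) (i′≡i+1 : i′ ≡ i + 1ℤ) (0≈i : 0ℤ ≈ i [mod k ]) (us : Vec (Vertex Δ) k-1) where

    private
      others-rest : ∀ (j : Fin k-1) → ¬ (+ toℕ (suc j) ≈ i [mod k ])
      others-rest j j≈i = ℕ.1+n≢0 (Fin-≈⇒≡ (suc j) 0 (s≤s z≤n)
        (≈-trans k (+ toℕ (suc j)) i 0ℤ j≈i (≈-sym k 0ℤ i 0≈i)))

    bottom top : Vertex Δ → Vertex (ℤDigraph Δ k)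
    bottom x = i , x ∷ us
    top    x = i′ , x ∷ us

    line-edge : ∀ {x y} → Edge Δ x y → Edge (ℤDigraph Δ k) (bottom x) (top y)
    line-edge x→y = i′≡i+1 , λ where
      zero    → (λ 0≉i → ⊥-elim (0≉i 0≈i)) , λ _ → x→y
      (suc j) → (λ _ → refl) , λ j≈i → ⊥-elim (others-rest j j≈i)

    line-edge⁻¹ : ∀ {x y} → Edge (ℤDigraph Δ k) (bottom x) (top y) → Edge Δ x y
    line-edge⁻¹ (_ , coord) = proj₂ (coord zero) 0≈i

    -- Only coordinate 0 moves out of level `i`. Together with `line-in` this shows that no arc
    -- leaving the bottom or entering the top leads out of the copy, so images can be followed
    -- inside it.
    line-out : ∀ {x} w → Edge (ℤDigraph Δ k) (bottom x) w → ∃[ y ] w ≡ top y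
    line-out (l , y ∷ ws) (l≡i+1 , coord) = y , cong₂ _,_ (trans l≡i+1 (sym i′≡i+1))
      (cong (y ∷_) (sym (lookup-injective λ j → proj₁ (coord (suc j)) (others-rest j))))

    line-in : ∀ {y} w → Edge (ℤDigraph Δ k) w (top y) → ∃[ x ] w ≡ bottom x
    line-in (l , x ∷ ws) (i′≡l+1 , coord) = x , cong₂ _,_ l≡i
      (cong (x ∷_) (lookup-injective λ j → proj₁ (coord (suc j))
        (subst (λ l → ¬ (+ toℕ (suc j) ≈ l [mod k ])) (sym l≡i) (others-rest j))))
      where
      l≡i : l ≡ i
      l≡i = ∙-cancelʳ ℤ.+-0-abelianGroup 1ℤ l i (trans (sym i′≡l+1) i′≡i+1)

    bottom-injective : ∀ {x y} → bottom x ≡ bottom y → x ≡ y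
    bottom-injective = ∷-injectiveˡ ∘ cong proj₂

    top-injective : ∀ {x y} → top x ≡ top y → x ≡ y
    top-injective = ∷-injectiveˡ ∘ cong proj₂

  -- Coordinate 0 goes along the arcs y → x → w, every other coordinate along y → x.
  module TestArcs {y x : Vertex Δ} (y→x : Edge Δ y x) where

    -- Coordinate `suc j` moves out of the level with its own number, so at level `m` it has reached
    -- `x` exactly when that number is below `m`.
    tail : ℕ → Vec (Vertex Δ) k-1
    tail m = tabulate (λ j → if toℕ (suc j) <ᵇ m then x else y)

    tail-end : tail k ≡ tail (ℕ.suc k)
    tail-end = tabulate-cong λ j → cong (if_then x else y)
      (trans (<ᵇ-true (toℕ<n j)) (sym (<ᵇ-true (ℕ.m<n⇒m<1+n (toℕ<n j)))))

    point : ℕ → Vertex Δ → Vertex (ℤDigraph Δ k)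
    point m t = + m , t ∷ tail m

    module Start = Line 0ℤ 1ℤ refl (≡⇒≈ k {0ℤ} refl) (tail 0)
    module End   = Line (+ k) (+ ℕ.suc k) (+suc k) 0≈k (tail k)

    End-top : ∀ t → point (ℕ.suc k) t ≡ End.top t
    End-top t = cong (λ us → + ℕ.suc k , t ∷ us) (sym tail-end)

    private
      0-rests : ∀ m → m ℕ.< k-1 → ¬ (0ℤ ≈ + ℕ.suc m [mod k ])
      0-rests m m<k-1 0≈m = ℕ.0≢1+n (Fin-≈⇒≡ zero (ℕ.suc m) (s≤s m<k-1) 0≈m)

    -- Below level `k` the moving coordinate is the one numbered `suc m`. The value `t` of
    -- coordinate 0 is arbitrary because `transport` follows a value other than that of the test
    -- arcs.
    inner-edge : ∀ m → m ℕ.< k-1 → ∀ t → Edge (ℤDigraph Δ k) (point (ℕ.suc m) t) (point (ℕ.suc (ℕ.suc m)) t)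
    inner-edge m m<k-1 t = +suc (ℕ.suc m) , coord
      where
      coord : ∀ j →
        (¬ (+ toℕ j ≈ + ℕ.suc m [mod k ]) → lookup (t ∷ tail (ℕ.suc m)) j ≡ lookup (t ∷ tail (ℕ.suc (ℕ.suc m))) j) ×
        (+ toℕ j ≈ + ℕ.suc m [mod k ] →
          Edge Δ (lookup (t ∷ tail (ℕ.suc m)) j) (lookup (t ∷ tail (ℕ.suc (ℕ.suc m))) j))
      coord zero = (λ _ → refl) , λ 0≈m → ⊥-elim (0-rests m m<k-1 0≈m)
      coord (suc j) rewrite lookup∘tabulate (λ j → if toℕ (suc j) <ᵇ ℕ.suc m then x else y) j
                     | lookup∘tabulate (λ j → if toℕ (suc j) <ᵇ ℕ.suc (ℕ.suc m) then x else y) j =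
        (λ j≉m → cong (if_then x else y) (<ᵇ-suc (toℕ j) m λ j≡m → j≉m (≡⇒≈ k (cong (+_ ∘ ℕ.suc) j≡m)))) ,
        -- Here `toℕ j` equals `m`: the first test fails, the second succeeds, and the coordinate
        -- goes from `y` to `x`.
        (λ j≈m → subst (λ m → Edge Δ (if toℕ j <ᵇ m then x else y) (if toℕ j <ᵇ ℕ.suc m then x else y))
          (ℕ.suc-injective (Fin-≈⇒≡ (suc j) (ℕ.suc m) (s≤s m<k-1) j≈m))
          (subst₂ (λ b c → Edge Δ (if b then x else y) (if c then x else y))
            (sym (<ᵇ-irrefl (toℕ j))) (sym (<ᵇ-true (ℕ.n<1+n (toℕ j)))) y→x))

    module _ {w : Vertex Δ} (x→w : Edge Δ x w) where

      path : ℕ → Vertex (ℤDigraph Δ k)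
      path ℕ.zero    = point 0 y
      -- Coordinate 0 stays at `x` on levels 1 to `k`; only the vertex at level `k + 1` depends on
      -- `w`.
      path (ℕ.suc m) = point (ℕ.suc m) (if m <ᵇ k then x else w)

      path-shared : ∀ m → m ℕ.< k → path (ℕ.suc m) ≡ point (ℕ.suc m) x
      path-shared m m<k = cong (λ b → point (ℕ.suc m) (if b then x else w)) (<ᵇ-true m<k)

      path-last : path (ℕ.suc k) ≡ End.top w
      path-last = trans (cong (λ b → point (ℕ.suc k) (if b then x else w)) (<ᵇ-irrefl k)) (End-top w)

      path-edge : ∀ m → m ℕ.≤ k → Edge (ℤDigraph Δ k) (path m) (path (ℕ.suc m))
      path-edge ℕ.zero    _           = Start.line-edge y→x
      path-edge (ℕ.suc m) (s≤s m≤k-1) = by-cases (ℕ.m≤n⇒m<n∨m≡n m≤k-1)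
        where
        by-cases : m ℕ.< k-1 ⊎ m ≡ k-1 → Edge (ℤDigraph Δ k) (path (ℕ.suc m)) (path (ℕ.suc (ℕ.suc m)))
        by-cases (inj₁ m<k-1) = subst₂ (Edge (ℤDigraph Δ k))
          (sym (path-shared m (s≤s m≤k-1))) (sym (path-shared (ℕ.suc m) (s≤s m<k-1))) (inner-edge m m<k-1 x)
        by-cases (inj₂ refl) = subst₂ (Edge (ℤDigraph Δ k))
          (sym (path-shared k-1 ℕ.≤-refl)) (sym path-last) (End.line-edge x→w)

      testArc : Arc (ℕ.suc k) (ℤDigraph Δ k)
      testArc .vertex i = path (toℕ i)
      testArc .edge i   = subst (λ m → Edge (ℤDigraph Δ k) (path m) (path (ℕ.suc (toℕ i))))
        (sym (toℕ-inject₁ i)) (path-edge (toℕ i) (ℕ.s≤s⁻¹ (toℕ<n i)))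

    -- The first two and the last two vertices of the test arcs, written as vertices of the two
    -- copies of CDHC(Δ).
    record TestAutomorphism (w w′ : Vertex Δ) : Set (v ⊔ e) where
      field
        φ           : Automorphism (ℤDigraph Δ k)
        fixes-start : to φ (Start.bottom y) ≡ Start.bottom y
        fixes-first : to φ (Start.top x) ≡ Start.top x
        fixes-end   : to φ (End.bottom x) ≡ End.bottom x
        moves-last  : to φ (End.top w) ≡ End.top w′

    testAutomorphism : ArcTransitive (ℕ.suc k) (ℤDigraph Δ k) → ∀ {w w′} → Edge Δ x w → Edge Δ x w′ →
                       TestAutomorphism w w′
    testAutomorphism transitive {w} {w′} x→w x→w′ = record
      { φ           = φ
      ; fixes-start = maps 0 z≤n
      ; fixes-first = maps 1 (s≤s z≤n)
      ; fixes-end   = subst₂ (λ p q → to φ p ≡ q) (path-shared x→w k-1 ℕ.≤-refl) (path-shared x→w′ k-1 ℕ.≤-refl)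
          (maps k (ℕ.n≤1+n k))
      ; moves-last  = subst₂ (λ p q → to φ p ≡ q) (path-last x→w) (path-last x→w′) (maps (ℕ.suc k) ℕ.≤-refl)
      }
      where
      φ = proj₁ (transitive (testArc x→w) (testArc x→w′))
      maps : ∀ m → m ℕ.≤ ℕ.suc k → to φ (path x→w m) ≡ path x→w′ m
      maps m m≤k+1 = subst (λ m → to φ (path x→w m) ≡ path x→w′ m) (toℕ-fromℕ< (s≤s m≤k+1))
        (proj₂ (transitive (testArc x→w) (testArc x→w′)) (fromℕ< (s≤s m≤k+1)))

    -- Coordinate 0 rests between levels 1 and k.
    transport : (φ : Automorphism (ℤDigraph Δ k)) → ∀ {t} → to φ (Start.top t) ≡ Start.top t →
                ∀ {t′} → to φ (End.bottom t) ≡ End.bottom t′ → t′ ≡ t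
    transport φ {t} fixed {t′} φt≡t′ = cong (head ∘ proj₂) (trans (sym φt≡t′) (proj₂ reached))
      where
      -- Only the level and coordinate 0 of the image are controlled; the remaining coordinates `ws`
      -- may change.
      keeps : ∀ m → m ℕ.≤ k-1 → ∃[ ws ] to φ (point (ℕ.suc m) t) ≡ (+ ℕ.suc m , t ∷ ws)
      keeps ℕ.zero    _     = tail 1 , fixed
      keeps (ℕ.suc m) m<k-1 =
        next (to φ (point (ℕ.suc (ℕ.suc m)) t)) (keeps m (ℕ.<⇒≤ m<k-1)) (to-edge φ (inner-edge m m<k-1 t))
        where
        next : ∀ u → ∃[ ws ] to φ (point (ℕ.suc m) t) ≡ (+ ℕ.suc m , t ∷ ws) →
               Edge (ℤDigraph Δ k) (to φ (point (ℕ.suc m) t)) u → ∃[ ws ] u ≡ (+ ℕ.suc (ℕ.suc m) , t ∷ ws)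
        next (l , s ∷ ss) (ws , eq) edge′ = ss , cong₂ (λ l s → l , s ∷ ss)
          (trans (proj₁ edge″) (sym (+suc (ℕ.suc m)))) (sym (proj₁ (proj₂ edge″ zero) (0-rests m m<k-1)))
          where
          edge″ : Edge (ℤDigraph Δ k) (+ ℕ.suc m , t ∷ ws) (l , s ∷ ss)
          edge″ = subst (λ z → Edge (ℤDigraph Δ k) z (l , s ∷ ss)) eq edge′
      reached : ∃[ ws ] to φ (End.bottom t) ≡ (+ k , t ∷ ws)
      reached = keeps k-1 ℕ.≤-refl

-- Cycles with loops

-- Covers Θ n and Θ∞, the latter for n = 0.
module _ {n : ℕ} (Δ : Digraph v e) (R : Residues n (Vertex Δ))
         (edge⇒ : ∀ {x y} → Edge Δ x y → label R y ≈ label R x [mod n ] ⊎ label R y ≈ label R x + 1ℤ [mod n ])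
         (edge⇐ : ∀ {x y} → label R y ≈ label R x [mod n ] ⊎ label R y ≈ label R x + 1ℤ [mod n ] → Edge Δ x y) where

  private
    module R = Residues R
    ℓ = R.label

  at-edge : ∀ i j → j ≈ i [mod n ] ⊎ j ≈ i + 1ℤ [mod n ] → Edge Δ (R.at i) (R.at j)
  at-edge i j (inj₁ p) = edge⇐ (inj₁ (≈-trans n (ℓ (R.at j)) j (ℓ (R.at i)) (R.label-at j)
    (≈-trans n j i (ℓ (R.at i)) p (≈-sym n (ℓ (R.at i)) i (R.label-at i)))))
  at-edge i j (inj₂ p) = edge⇐ (inj₂ (≈-combine n (ℓ (R.at j)) (i + 1ℤ) i (ℓ (R.at i)) (ℓ (R.at j)) (ℓ (R.at i) + 1ℤ)
    (lemma (ℓ (R.at j)) i (ℓ (R.at i)))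
    (≈-trans n (ℓ (R.at j)) j (i + 1ℤ) (R.label-at j) p) (≈-sym n (ℓ (R.at i)) i (R.label-at i))))
    where
    lemma : ∀ y i x → (y - (i + 1ℤ)) + (i - x) ≡ y - (x + 1ℤ)
    lemma = solve-∀

  -- Rotations and reflections as twists

  private
    rotate : ℤ → Vertex Δ → Vertex Δ
    rotate c x = R.at (ℓ x + c)

    rotate-inverse : ∀ c d → c + d ≡ 0ℤ → ∀ x → rotate c (rotate d x) ≡ x
    rotate-inverse c d c+d≡0 x = R.at-≡ (ℓ (rotate d x) + c) x
      (≈-resp n (ℓ (rotate d x)) (ℓ x + d) (ℓ (rotate d x) + c) (ℓ x)
        (trans (lemma (ℓ (rotate d x)) (ℓ x) c d)
          (trans (cong (λ z → ℓ (rotate d x) + c - ℓ x - z) c+d≡0) (ℤ.+-identityʳ _)))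
        (R.label-at (ℓ x + d)))
      where
      lemma : ∀ y x c d → y - (x + d) ≡ y + c - x - (c + d)
      lemma = solve-∀

    rotate-edge : ∀ c {x y} → Edge Δ x y → Edge Δ (rotate c x) (rotate c y)
    rotate-edge c {x} {y} x→y = at-edge (ℓ x + c) (ℓ y + c) (shifted (edge⇒ x→y))
      where
      lemma₁ : ∀ x y c → y - x ≡ y + c - (x + c)
      lemma₁ = solve-∀
      lemma₂ : ∀ x y c → y - (x + 1ℤ) ≡ y + c - (x + c + 1ℤ)
      lemma₂ = solve-∀
      shifted : ℓ y ≈ ℓ x [mod n ] ⊎ ℓ y ≈ ℓ x + 1ℤ [mod n ] →
                ℓ y + c ≈ ℓ x + c [mod n ] ⊎ ℓ y + c ≈ ℓ x + c + 1ℤ [mod n ]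
      shifted (inj₁ p) = inj₁ (≈-resp n (ℓ y) (ℓ x) (ℓ y + c) (ℓ x + c) (lemma₁ (ℓ x) (ℓ y) c) p)
      shifted (inj₂ p) = inj₂ (≈-resp n (ℓ y) (ℓ x + 1ℤ) (ℓ y + c) (ℓ x + c + 1ℤ) (lemma₂ (ℓ x) (ℓ y) c) p)

    rotation : ℤ → Twist Δ
    rotation c = record
      { act        = λ _ → rotate c
      ; unact      = λ _ → rotate (- c)
      ; act∘unact  = λ _ → rotate-inverse c (- c) (ℤ.+-inverseʳ c)
      ; unact∘act  = λ _ → rotate-inverse (- c) c (ℤ.+-inverseˡ c)
      ; act-edge   = λ _ → rotate-edge c
      ; unact-edge = λ _ → rotate-edge (- c)
      }

    reflect : ℤ → Vertex Δ → Vertex Δ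
    reflect s x = R.at (s - ℓ x)

    reflect-involutive : ∀ s x → reflect s (reflect s x) ≡ x
    reflect-involutive s x = R.at-≡ (s - ℓ (reflect s x)) x
      (≈-resp n (s - ℓ x) (ℓ (reflect s x)) (s - ℓ (reflect s x)) (ℓ x) (lemma s (ℓ x) (ℓ (reflect s x)))
        (≈-sym n (ℓ (reflect s x)) (s - ℓ x) (R.label-at (s - ℓ x))))
      where
      lemma : ∀ s x y → s - x - y ≡ s - y - x
      lemma = solve-∀

    reflect-edge : ∀ c t {x y} → Edge Δ x y → Edge Δ (reflect (c + t) x) (reflect (c + (t + 1ℤ)) y)
    reflect-edge c t {x} {y} x→y = at-edge (c + t - ℓ x) (c + (t + 1ℤ) - ℓ y) (swapped (edge⇒ x→y))
      where
      lemma₁ : ∀ x y c t → x - y ≡ c + (t + 1ℤ) - y - (c + t - x + 1ℤ)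
      lemma₁ = solve-∀
      lemma₂ : ∀ x y c t → x + 1ℤ - y ≡ c + (t + 1ℤ) - y - (c + t - x)
      lemma₂ = solve-∀
      swapped : ℓ y ≈ ℓ x [mod n ] ⊎ ℓ y ≈ ℓ x + 1ℤ [mod n ] →
                c + (t + 1ℤ) - ℓ y ≈ c + t - ℓ x [mod n ] ⊎ c + (t + 1ℤ) - ℓ y ≈ c + t - ℓ x + 1ℤ [mod n ]
      swapped (inj₁ p) = inj₂ (≈-resp n (ℓ x) (ℓ y) (c + (t + 1ℤ) - ℓ y) (c + t - ℓ x + 1ℤ) (lemma₁ (ℓ x) (ℓ y) c t)
        (≈-sym n (ℓ y) (ℓ x) p))
      swapped (inj₂ p) = inj₁ (≈-resp n (ℓ x + 1ℤ) (ℓ y) (c + (t + 1ℤ) - ℓ y) (c + t - ℓ x) (lemma₂ (ℓ x) (ℓ y) c t)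
        (≈-sym n (ℓ y) (ℓ x + 1ℤ) p))

    -- Moving the centre along with t makes the reflections exchange the loops
    -- and the arcs x → x + 1.
    reflection : ℤ → Twist Δ
    reflection c = record
      { act        = λ t → reflect (c + t)
      ; unact      = λ t → reflect (c + t)
      ; act∘unact  = λ t → reflect-involutive (c + t)
      ; unact∘act  = λ t → reflect-involutive (c + t)
      ; act-edge   = λ t → reflect-edge c t
      ; unact-edge = λ t → reflect-edge c t
      }

    rotation-sends : ∀ x x′ → rotate (ℓ x′ - ℓ x) x ≡ x′
    rotation-sends x x′ = R.at-≡ (ℓ x + (ℓ x′ - ℓ x)) x′ (≡⇒≈ n (lemma (ℓ x) (ℓ x′)))
      where
      lemma : ∀ x x′ → x + (x′ - x) ≡ x′
      lemma = solve-∀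

    -- The constant `ℓ x′ + ℓ x` makes the reflection at time 0 exchange `x` and `x′`; the summand
    -- `0ℤ` is that time.
    reflection-sends : ∀ x x′ → reflect (ℓ x′ + ℓ x + 0ℤ) x ≡ x′
    reflection-sends x x′ = R.at-≡ (ℓ x′ + ℓ x + 0ℤ - ℓ x) x′ (≡⇒≈ n (lemma (ℓ x) (ℓ x′)))
      where
      lemma : ∀ x x′ → x′ + x + 0ℤ - x ≡ x′
      lemma = solve-∀

  -- Arcs of the same kind are matched by a rotation, a loop and a non-loop by a reflection. The
  -- twist is chosen to send `x` to `x′`; the congruences of the two arcs then give the image of
  -- `y`.
  residues⇒twistTransitive : TwistTransitive Δ
  residues⇒twistTransitive {x} {y} {x′} {y′} x→y x′→y′ = choose (edge⇒ x→y) (edge⇒ x′→y′)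
    where
    lemma₁ : ∀ x y x′ y′ → (y - x) + (x′ - y′) ≡ y + (x′ - x) - y′
    lemma₁ = solve-∀
    lemma₂ : ∀ x y x′ y′ → (y - (x + 1ℤ)) + (x′ + 1ℤ - y′) ≡ y + (x′ - x) - y′
    lemma₂ = solve-∀
    lemma₃ : ∀ x y x′ y′ → (x - y) + (x′ + 1ℤ - y′) ≡ x′ + x + 1ℤ - y - y′
    lemma₃ = solve-∀
    lemma₄ : ∀ x y x′ y′ → (x + 1ℤ - y) + (x′ - y′) ≡ x′ + x + 1ℤ - y - y′
    lemma₄ = solve-∀
    choose : ℓ y ≈ ℓ x [mod n ] ⊎ ℓ y ≈ ℓ x + 1ℤ [mod n ] →
             ℓ y′ ≈ ℓ x′ [mod n ] ⊎ ℓ y′ ≈ ℓ x′ + 1ℤ [mod n ] →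
             Σ[ g ∈ Twist Δ ] Twist.act g 0ℤ x ≡ x′ × Twist.act g 1ℤ y ≡ y′
    choose (inj₁ p) (inj₁ q) = rotation (ℓ x′ - ℓ x) , rotation-sends x x′ ,
      R.at-≡ (ℓ y + (ℓ x′ - ℓ x)) y′ (≈-combine n (ℓ y) (ℓ x) (ℓ x′) (ℓ y′) (ℓ y + (ℓ x′ - ℓ x)) (ℓ y′)
        (lemma₁ (ℓ x) (ℓ y) (ℓ x′) (ℓ y′)) p (≈-sym n (ℓ y′) (ℓ x′) q))
    choose (inj₂ p) (inj₂ q) = rotation (ℓ x′ - ℓ x) , rotation-sends x x′ ,
      R.at-≡ (ℓ y + (ℓ x′ - ℓ x)) y′ (≈-combine n (ℓ y) (ℓ x + 1ℤ) (ℓ x′ + 1ℤ) (ℓ y′) (ℓ y + (ℓ x′ - ℓ x)) (ℓ y′)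
        (lemma₂ (ℓ x) (ℓ y) (ℓ x′) (ℓ y′)) p (≈-sym n (ℓ y′) (ℓ x′ + 1ℤ) q))
    choose (inj₁ p) (inj₂ q) = reflection (ℓ x′ + ℓ x) , reflection-sends x x′ ,
      R.at-≡ (ℓ x′ + ℓ x + 1ℤ - ℓ y) y′ (≈-combine n (ℓ x) (ℓ y) (ℓ x′ + 1ℤ) (ℓ y′) (ℓ x′ + ℓ x + 1ℤ - ℓ y) (ℓ y′)
        (lemma₃ (ℓ x) (ℓ y) (ℓ x′) (ℓ y′)) (≈-sym n (ℓ y) (ℓ x) p) (≈-sym n (ℓ y′) (ℓ x′ + 1ℤ) q))
    choose (inj₂ p) (inj₁ q) = reflection (ℓ x′ + ℓ x) , reflection-sends x x′ ,
      R.at-≡ (ℓ x′ + ℓ x + 1ℤ - ℓ y) y′ (≈-combine n (ℓ x + 1ℤ) (ℓ y) (ℓ x′) (ℓ y′) (ℓ x′ + ℓ x + 1ℤ - ℓ y) (ℓ y′)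
        (lemma₄ (ℓ x) (ℓ y) (ℓ x′) (ℓ y′)) (≈-sym n (ℓ y) (ℓ x + 1ℤ) p) (≈-sym n (ℓ y′) (ℓ x′) q))

  -- Failure of (k+1)-arc-transitivity for cycles with loops

  module _ (1≉0 : ¬ (1ℤ ≈ 0ℤ [mod n ])) (2≉0 : ¬ (+ 2 ≈ 0ℤ [mod n ])) (k-1 : ℕ) where

    private
      k : ℕ
      k = ℕ.suc k-1

      o s : Vertex Δ
      o = at R 0ℤ
      s = at R 1ℤ

      s≢o : s ≢ o
      s≢o = 1≉0 ∘ at-injective R 1ℤ 0ℤ

      o→o : Edge Δ o o
      o→o = at-edge 0ℤ 0ℤ (inj₁ (≡⇒≈ n {0ℤ} refl))

      o→s : Edge Δ o s
      o→s = at-edge 0ℤ 1ℤ (inj₂ (≡⇒≈ n {1ℤ} refl))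

      s→s : Edge Δ s s
      s→s = at-edge 1ℤ 1ℤ (inj₁ (≡⇒≈ n {1ℤ} refl))

      out : ∀ i {u} → Edge Δ (at R i) u → u ≡ at R i ⊎ u ≡ at R (i + 1ℤ)
      out i {u} i→u = by-cases (edge⇒ i→u)
        where
        lemma : ∀ x u i → (x + 1ℤ - u) + (i - x) ≡ i + 1ℤ - u
        lemma = solve-∀
        by-cases : label R u ≈ label R (at R i) [mod n ] ⊎ label R u ≈ label R (at R i) + 1ℤ [mod n ] →
                   u ≡ at R i ⊎ u ≡ at R (i + 1ℤ)
        by-cases (inj₁ p) = inj₁ (label-injective R u (at R i) p)
        by-cases (inj₂ p) = inj₂ (sym (at-≡ R (i + 1ℤ) u
          (≈-combine n (label R (at R i) + 1ℤ) (label R u) i (label R (at R i)) (i + 1ℤ) (label R u)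
            (lemma (label R (at R i)) (label R u) i)
            (≈-sym n (label R u) (label R (at R i) + 1ℤ) p) (≈-sym n (label R (at R i)) i (label-at R i)))))

      -- The out-neighbours of `o` are the residues 0 and 1, those of `s` are 1 and 2. That 0 and 2
      -- differ is where `n ≥ 3` enters for finite cycles.
      common-out : ∀ {u} → Edge Δ o u → Edge Δ s u → u ≡ s
      common-out o→u s→u with out 0ℤ o→u | out 1ℤ s→u
      ... | inj₂ u≡s | _         = u≡s
      ... | _        | inj₁ u≡s  = u≡s
      ... | inj₁ u≡o | inj₂ u≡2  = ⊥-elim (2≉0 (at-injective R (+ 2) 0ℤ (trans (sym u≡2) u≡o)))

      -- Both `y` and `x` are `o`: the test arcs begin with the loop and end with the loop or with
      -- `o→s`.
      open TestArcs Δ k-1 o→o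

      contradiction : ¬ TestAutomorphism o s
      contradiction test = s≢o (sym (End.top-injective (to-injective φ (trans moves-last (sym end-fixed)))))
        where
        open TestAutomorphism test

        -- The initial vertex has two out-neighbours; `φ` fixes one of them, hence also the other.
        start-fixed : to φ (Start.top s) ≡ Start.top s
        start-fixed = by-cases (Start.line-out (to φ (Start.top s)) o→φs)
          where
          o→φs : Edge (ℤDigraph Δ k) (Start.bottom o) (to φ (Start.top s))
          o→φs = subst (λ p → Edge (ℤDigraph Δ k) p (to φ (Start.top s))) fixes-start (to-edge φ (Start.line-edge o→s))
          only : ∀ u → to φ (Start.top s) ≡ Start.top u → u ≡ o ⊎ u ≡ s → to φ (Start.top s) ≡ Start.top s
          only u eq (inj₁ u≡o) = ⊥-elim (s≢o (Start.top-injective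
            (to-injective φ (trans eq (trans (cong Start.top u≡o) (sym fixes-first))))))
          only u eq (inj₂ u≡s) = trans eq (cong Start.top u≡s)
          by-cases : ∃[ u ] to φ (Start.top s) ≡ Start.top u → to φ (Start.top s) ≡ Start.top s
          by-cases (u , eq) =
            only u eq (out 0ℤ (Start.line-edge⁻¹ (subst (Edge (ℤDigraph Δ k) (Start.bottom o)) eq o→φs)))

        -- By `transport` the bottom vertex at `s` is fixed as well, so the image of the top vertex
        -- at `s` is a common out-neighbour of `o` and `s`.
        end-fixed : to φ (End.top s) ≡ End.top s
        end-fixed = common (End.line-out (to φ (End.top s)) o→φs)
          where
          o→φs : Edge (ℤDigraph Δ k) (End.bottom o) (to φ (End.top s))
          o→φs = subst (λ p → Edge (ℤDigraph Δ k) p (to φ (End.top s))) fixes-end (to-edge φ (End.line-edge o→s))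
          common : ∃[ u ] to φ (End.top s) ≡ End.top u → to φ (End.top s) ≡ End.top s
          common (u , eq) = trans eq (cong End.top (common-out
            (End.line-edge⁻¹ (subst (Edge (ℤDigraph Δ k) (End.bottom o)) eq o→φs))
            (from-s (End.line-in (to φ (End.bottom s)) φs→u))))
            where
            φs→u : Edge (ℤDigraph Δ k) (to φ (End.bottom s)) (End.top u)
            φs→u = subst (Edge (ℤDigraph Δ k) (to φ (End.bottom s))) eq (to-edge φ (End.line-edge s→s))
            from-s : ∃[ t ] to φ (End.bottom s) ≡ End.bottom t → Edge Δ s u
            from-s (t , φs≡t) = End.line-edge⁻¹ (subst (λ p → Edge (ℤDigraph Δ k) p (End.top u))
              (trans φs≡t (cong End.bottom (transport φ start-fixed φs≡t))) φs→u)

    residues⇒sharplyArcTransitive : SharplyArcTransitive k (ℤDigraph Δ k)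
    residues⇒sharplyArcTransitive =
      twistTransitive⇒arcTransitive Δ k residues⇒twistTransitive ,
      λ transitive → contradiction (testAutomorphism transitive o→o o→s)

Θ-sharplyArcTransitive : ∀ n k-1 → n ℕ.≥ 3 → SharplyArcTransitive (ℕ.suc k-1) (ℤDigraph (Θ n) (ℕ.suc k-1))
Θ-sharplyArcTransitive n@(ℕ.suc _) k-1 n≥3 = residues⇒sharplyArcTransitive (Θ n) (Fin-residues n)
  (λ { (inj₁ y≡x) → inj₁ (≡⇒≈ n (cong (+_ ∘ toℕ) y≡x)) ; (inj₂ p) → inj₂ p })
  (λ { {x} {y} (inj₁ p) → inj₁ (label-injective (Fin-residues n) y x p) ; (inj₂ p) → inj₂ p })
  (λ 1≈0 → 1≢0 (<∧≈0⇒≡0 n 1ℤ (ℕ.<-≤-trans (ℕ.s≤s (ℕ.s≤s z≤n)) n≥3) 1≈0))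
  (λ 2≈0 → 2≢0 (<∧≈0⇒≡0 n (+ 2) n≥3 2≈0))
  k-1
  where
  1≢0 : 1ℤ ≢ 0ℤ
  1≢0 ()
  2≢0 : + 2 ≢ 0ℤ
  2≢0 ()

Θ∞-sharplyArcTransitive : ∀ k-1 → SharplyArcTransitive (ℕ.suc k-1) (ℤDigraph Θ∞ (ℕ.suc k-1))
Θ∞-sharplyArcTransitive = residues⇒sharplyArcTransitive Θ∞ ℤ-residues
  (λ { (inj₁ y≡x) → inj₁ (≡⇒≈ 0 y≡x) ; (inj₂ y≡x+1) → inj₂ (≡⇒≈ 0 y≡x+1) })
  (λ { {x} {y} (inj₁ p) → inj₁ (≈0⇒≡ y x p) ; {x} {y} (inj₂ p) → inj₂ (≈0⇒≡ y (x + 1ℤ) p) })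
  (λ 1≈0 → 1≢0 (≈0⇒≡ 1ℤ 0ℤ 1≈0))
  (λ 2≈0 → 2≢0 (≈0⇒≡ (+ 2) 0ℤ 2≈0))
  where
  1≢0 : 1ℤ ≢ 0ℤ
  1≢0 ()
  2≢0 : + 2 ≢ 0ℤ
  2≢0 ()

-- Stable digraphs

-- In CDHC(Δ) the number s ∈ {0,1} doubles as the parity of a walk of Δ.
data Walk (Δ : Digraph v e) (x : Vertex Δ) : Fin 2 → Vertex Δ → Set (v ⊔ e) where
  start  : Walk Δ x 0F x
  extend : ∀ {s u w} → Walk Δ x s u → Edge Δ u w → Walk Δ x (opposite s) w

-- For symmetric Δ this says that `(x , 0F)` is joined in CDHC(Δ) to both copies of `u`.
BothParities : (Δ : Digraph v e) → Vertex Δ → Vertex Δ → Set (v ⊔ e)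
BothParities Δ x u = ∀ s → Walk Δ x s u

opposite-≢ : ∀ (s t : Fin 2) → s ≢ t → s ≡ opposite t
opposite-≢ 0F 0F s≢t = ⊥-elim (s≢t refl)
opposite-≢ 0F 1F s≢t = refl
opposite-≢ 1F 0F s≢t = refl
opposite-≢ 1F 1F s≢t = ⊥-elim (s≢t refl)

-- Consequences of stability

module _ (Δ : Digraph v e) (stable : Stable Δ) where

  private
    Twins : Vertex Δ → Pred (Vertex (CDHC Δ)) _
    Twins x = ｛ x , 0F ｝ ∪ ｛ x , 1F ｝

    member : ∀ {x} s → Twins x (x , s)
    member 0F = inj₁ refl
    member 1F = inj₂ refl

  -- A block with a fixed point meets its image, so it is mapped to itself; having only two
  -- elements, it is then fixed pointwise.
  twin-fixed : (g : Automorphism (CDHC Δ)) → ∀ {x} s → to g (x , s) ≡ (x , s) → ∀ t → to g (x , t) ≡ (x , t)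
  twin-fixed g {x} s fixed t with stable x g
  ... | inj₂ disjoint = ⊥-elim (disjoint (x , s) (member s , (x , s) , member s , fixed))
  ... | inj₁ (image⊆ , _) = by-cases s t fixed
    where
    collapse : ∀ {s t} → to g (x , s) ≡ (x , s) → (x , s) ≡ to g (x , t) → s ≡ t
    collapse fixed eq = cong proj₂ (to-injective g (trans fixed eq))
    by-cases : ∀ s t → to g (x , s) ≡ (x , s) → to g (x , t) ≡ (x , t)
    by-cases 0F 0F fixed = fixed
    by-cases 1F 1F fixed = fixed
    by-cases 0F 1F fixed with image⊆ ((x , 1F) , member 1F , refl)
    ... | inj₂ eq = sym eq
    ... | inj₁ eq with () ← collapse fixed eq
    by-cases 1F 0F fixed with image⊆ ((x , 0F) , member 0F , refl)
    ... | inj₁ eq = sym eq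
    ... | inj₂ eq with () ← collapse fixed eq

-- Parity of walks in connected symmetric digraphs

module _ (Δ : Digraph v e) (connected : Connected Δ) (symmetric : Symmetric (Edge Δ)) where

  private
    walk-along : ∀ {x s u w} → Walk Δ x s u → EqClosure (Edge Δ) u w → ∃[ t ] Walk Δ x t w
    walk-along walk ε            = _ , walk
    walk-along walk (fwd u→w ◅ r) = walk-along (extend walk u→w) r
    walk-along walk (bwd w→u ◅ r) = walk-along (extend walk (symmetric w→u)) r

  -- The parity of the one walk that `connected` supplies. It is a proper 2-colouring if there is no
  -- odd closed walk at `x`.
  parity : Vertex Δ → Vertex Δ → Fin 2
  parity x u = proj₁ (walk-along start (connected x u))

  parity-walk : ∀ x u → Walk Δ x (parity x u) u
  parity-walk x u = proj₂ (walk-along start (connected x u))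

  prepend : ∀ {x y s u} → Edge Δ x y → Walk Δ y s u → Walk Δ x (opposite s) u
  prepend x→y start             = extend start x→y
  prepend x→y (extend walk u→w) = extend (prepend x→y walk) u→w

  bothParities-extend : ∀ {x u w} → BothParities Δ x u → Edge Δ u w → BothParities Δ x w
  bothParities-extend both u→w 0F = extend (both 1F) u→w
  bothParities-extend both u→w 1F = extend (both 0F) u→w

  bothParities-prepend : ∀ {x y u} → Edge Δ x y → BothParities Δ y u → BothParities Δ x u
  bothParities-prepend x→y both 0F = prepend x→y (both 1F)
  bothParities-prepend x→y both 1F = prepend x→y (both 0F)

  bothParities-anywhere : ∀ {x u} → BothParities Δ x u → ∀ w → BothParities Δ x w
  bothParities-anywhere {u = u} both w = along both (connected u w)
    where
    along : ∀ {x u w} → BothParities Δ x u → EqClosure (Edge Δ) u w → BothParities Δ x w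
    along both ε             = both
    along both (fwd u→w ◅ r) = along (bothParities-extend both u→w) r
    along both (bwd w→u ◅ r) = along (bothParities-extend both (symmetric w→u)) r

  odd-closed⇒bothParities : ∀ {x} → Walk Δ x 1F x → ∀ w → BothParities Δ x w
  odd-closed⇒bothParities odd = bothParities-anywhere λ { 0F → start ; 1F → odd }

  parity-self : ∀ {x} → ¬ Walk Δ x 1F x → parity x x ≡ 0F
  parity-self {x} ¬odd = opposite-≢ (parity x x) 1F λ eq → ¬odd (subst (λ s → Walk Δ x s x) eq (parity-walk x x))

  -- If adjacent vertices had equal parity, extending the walk to `u` would give walks of both
  -- parities to `w`, hence an odd walk from `x` back to `x`.
  parity-alternates : ∀ {x} → ¬ Walk Δ x 1F x → ∀ {u w} → Edge Δ u w → parity x w ≡ opposite (parity x u)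
  parity-alternates {x} ¬odd {u} {w} u→w = opposite-≢ (parity x w) (parity x u) λ eq →
    ¬odd (bothParities-anywhere (both (parity x u) (extend (parity-walk x u) u→w)
      (subst (λ s → Walk Δ x s w) eq (parity-walk x w))) x 1F)
    where
    both : ∀ s → Walk Δ x (opposite s) w → Walk Δ x s w → BothParities Δ x w
    both 0F odd even 0F = even
    both 0F odd even 1F = odd
    both 1F even odd 0F = even
    both 1F even odd 1F = odd

  has-neighbour : ∀ {x y} → Edge Δ x y → ∀ u → ∃[ w ] Edge Δ u w
  has-neighbour {x} {y} x→y u with connected u x
  ... | ε            = y , x→y
  ... | fwd u→w ◅ _  = _ , u→w
  ... | bwd w→u ◅ _  = _ , symmetric w→u

  module _ (neighbour : ∀ u → ∃[ w ] Edge Δ u w) where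

    half : Automorphism (CDHC Δ) → Fin 2 → Vertex Δ → Vertex Δ
    half g s u = proj₁ (to g (u , s))

    -- Every vertex of CDHC(Δ) lies on an arc here, and the second component of a vertex tells
    -- whether it is a tail or a head. So `g` is a pair of permutations of the vertices of Δ.
    to-half : ∀ g s u → to g (u , s) ≡ (half g s u , s)
    to-half g 0F u with w , u→w ← neighbour u = cong (half g 0F u ,_) (proj₁ (to-edge g {u , 0F} {w , 1F} (refl , refl , u→w)))
    to-half g 1F u with w , u→w ← neighbour u =
      cong (half g 1F u ,_) (proj₁ (proj₂ (to-edge g {w , 0F} {u , 1F} (refl , refl , symmetric u→w))))

    half-inverse : ∀ g s u → half g s (half (inverse g) s u) ≡ u
    half-inverse g s u = cong proj₁ (trans (cong (to g) (sym (to-half (inverse g) s u))) (to∘from g (u , s)))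

    half-edge : ∀ g s {u w} → Edge Δ u w → Edge Δ (half g s u) (half g (opposite s) w)
    half-edge g 0F {u} {w} u→w = proj₂ (proj₂ (to-edge g {u , 0F} {w , 1F} (refl , refl , u→w)))
    half-edge g 1F {u} {w} u→w = symmetric (proj₂ (proj₂ (to-edge g {w , 0F} {u , 1F} (refl , refl , symmetric u→w))))

    private
      ℤ-parity : ℤ → Fin 2
      ℤ-parity = ℤ-rec (λ _ → opposite) (λ _ → opposite) (λ _ → opposite-involutive) 0F

    -- As E is symmetric, (a, b) is an automorphism of CDHC(Δ) if and only if (b, a) is.
    alternate : Automorphism (CDHC Δ) → Twist Δ
    alternate g = record
      { act        = half g ∘ ℤ-parity
      ; unact      = half (inverse g) ∘ ℤ-parity
      ; act∘unact  = half-inverse g ∘ ℤ-parity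
      ; unact∘act  = half-inverse (inverse g) ∘ ℤ-parity
      ; act-edge   = edges g
      ; unact-edge = edges (inverse g)
      }
      where
      edges : ∀ g t {x y} → Edge Δ x y → Edge Δ (half g (ℤ-parity t) x) (half g (ℤ-parity (t + 1ℤ)) y)
      edges g t {x} {y} x→y = subst (λ s → Edge Δ (half g (ℤ-parity t) x) (half g s y))
        (sym (ℤ-rec-step (λ _ → opposite) (λ _ → opposite) (λ _ → opposite-involutive) 0F t))
        (half-edge g (ℤ-parity t) x→y)

    -- For bipartite Δ the graph CDHC(Δ) falls into two halves, and an automorphism
    -- that preserves one of them may be replaced by the identity on the other.
    module Bipartite {x : Vertex Δ} (¬odd : ¬ Walk Δ x 1F x) where

      private
        p : Vertex Δ → Fin 2
        p = parity x

        Preserves : Automorphism (CDHC Δ) → Set _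
        Preserves g = ∀ s u → p u ≡ s → p (half g s u) ≡ s

        -- Along a walk from `x` the parities of a vertex and of its image both alternate, and they
        -- agree at `x`.
        fixing⇒preserves : ∀ g → to g (x , 0F) ≡ (x , 0F) → Preserves g
        fixing⇒preserves g fixed .(p u) u refl = along (parity-walk x u)
          where
          along : ∀ {s u} → Walk Δ x s u → p (half g s u) ≡ s
          along start                     = trans (cong (p ∘ proj₁) fixed) (parity-self ¬odd)
          along (extend {s} {u} walk u→w) =
            trans (parity-alternates ¬odd (half-edge g s u→w)) (cong opposite (along walk))

        -- The vertices with `p u ≡ s` form the half that contains `(x , 0F)`.
        restrict : Automorphism (CDHC Δ) → Vertex (CDHC Δ) → Vertex (CDHC Δ)
        restrict g (u , s) = (if does (p u ≟ s) then half g s u else u) , s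

        restrict-in : ∀ g {u s} → p u ≡ s → restrict g (u , s) ≡ (half g s u , s)
        restrict-in g {u} {s} pu≡s = cong (λ b → (if b then half g s u else u) , s) (dec-true (p u ≟ s) pu≡s)

        restrict-out : ∀ g {u s} → p u ≢ s → restrict g (u , s) ≡ (u , s)
        restrict-out g {u} {s} pu≢s = cong (λ b → (if b then half g s u else u) , s) (dec-false (p u ≟ s) pu≢s)

        restrict-inverse : ∀ g h → Preserves h → (∀ s u → half g s (half h s u) ≡ u) →
                           ∀ us → restrict g (restrict h us) ≡ us
        restrict-inverse g h preserves-h g∘h (u , s) with p u ≟ s
        ... | yes pu≡s = trans (restrict-in g (preserves-h s u pu≡s)) (cong (_, s) (g∘h s u))
        ... | no  pu≢s = restrict-out g pu≢s

        -- Parity and second component both alternate along an arc, so its two ends lie in the same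
        -- half.
        restrict-edge : ∀ g us wt → Edge (CDHC Δ) us wt → Edge (CDHC Δ) (restrict g us) (restrict g wt)
        restrict-edge g (u , 0F) (w , 1F) (refl , refl , u→w) = by-cases (p u ≟ 0F)
          where
          by-cases : Dec (p u ≡ 0F) → Edge (CDHC Δ) (restrict g (u , 0F)) (restrict g (w , 1F))
          by-cases (yes pu≡0) = subst₂ (Edge (CDHC Δ)) (sym (restrict-in g pu≡0))
            (sym (restrict-in g (trans (parity-alternates ¬odd u→w) (cong opposite pu≡0))))
            (refl , refl , half-edge g 0F u→w)
          by-cases (no pu≢0) = subst₂ (Edge (CDHC Δ)) (sym (restrict-out g pu≢0))
            (sym (restrict-out g λ pw≡1 → pu≢0 (trans (sym (opposite-involutive (p u)))
              (cong opposite (trans (sym (parity-alternates ¬odd u→w)) pw≡1)))))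
            (refl , refl , u→w)

        restriction : (g : Automorphism (CDHC Δ)) → to g (x , 0F) ≡ (x , 0F) → Automorphism (CDHC Δ)
        restriction g fixed = mkAutomorphism (restrict g) (restrict (inverse g))
          (restrict-inverse g (inverse g) (fixing⇒preserves (inverse g) from-fixed) (half-inverse g))
          (restrict-inverse (inverse g) g (fixing⇒preserves g fixed) (half-inverse (inverse g)))
          (restrict-edge g) (restrict-edge (inverse g))
          where
          from-fixed : from g (x , 0F) ≡ (x , 0F)
          from-fixed = trans (cong (from g) (sym fixed)) (from∘to g (x , 0F))

      -- The vertex `(y , 0F)` lies in the other half, where the restriction is the identity. By
      -- stability the restriction also fixes `(y , 1F)`, and there it agrees with `g`.
      fixes-neighbours : Stable Δ → (g : Automorphism (CDHC Δ)) → to g (x , 0F) ≡ (x , 0F) →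
                         ∀ {y} → Edge Δ x y → to g (y , 1F) ≡ (y , 1F)
      fixes-neighbours stable g fixed {y} x→y = trans (to-half g 1F y) (trans (sym (restrict-in g py≡1))
        (twin-fixed Δ stable (restriction g fixed) 0F (restrict-out g λ py≡0 → 1≢0 (trans (sym py≡1) py≡0)) 1F))
        where
        py≡1 : p y ≡ 1F
        py≡1 = trans (parity-alternates ¬odd x→y) (cong opposite (parity-self ¬odd))
        1≢0 : _≢_ {A = Fin 2} 1F 0F
        1≢0 ()

  -- The action on a copy of CDHC(Δ)

  module LineAction (k-1 : ℕ) (i i′ : ℤ) (i′≡i+1 : i′ ≡ i + 1ℤ) (0≈i : 0ℤ ≈ i [mod ℕ.suc k-1 ]) (us : Vec (Vertex Δ) k-1) where

    private
      k : ℕ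
      k = ℕ.suc k-1

      module L = Line Δ k-1 i i′ i′≡i+1 0≈i us

      place : Vertex (CDHC Δ) → Vertex (ℤDigraph Δ k)
      place (u , 0F) = L.bottom u
      place (u , 1F) = L.top u

      place-injective : ∀ {u w} s → place (u , s) ≡ place (w , s) → u ≡ w
      place-injective 0F = L.bottom-injective
      place-injective 1F = L.top-injective

    module _ {c : Vertex Δ} (both : ∀ u → BothParities Δ c u) where

      private
        Fixing : Automorphism (ℤDigraph Δ k) → Set _
        Fixing φ = to φ (L.bottom c) ≡ L.bottom c

        -- The walk is traversed alternately up, by `line-out`, and down, by `line-in`, so the
        -- images never leave the copy.
        along : ∀ φ → Fixing φ → ∀ {s u} → Walk Δ c s u → ∃[ u′ ] to φ (place (u , s)) ≡ place (u′ , s)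
        along φ fixed start = c , fixed
        along φ fixed (extend {0F} {u} {w} walk u→w) = next (along φ fixed walk)
          where
          next : ∃[ u′ ] to φ (L.bottom u) ≡ L.bottom u′ → ∃[ w′ ] to φ (L.top w) ≡ L.top w′
          next (u′ , eq) = L.line-out (to φ (L.top w))
            (subst (λ q → Edge (ℤDigraph Δ k) q (to φ (L.top w))) eq (to-edge φ (L.line-edge u→w)))
        along φ fixed (extend {1F} {u} {w} walk u→w) = next (along φ fixed walk)
          where
          next : ∃[ u′ ] to φ (L.top u) ≡ L.top u′ → ∃[ w′ ] to φ (L.bottom w) ≡ L.bottom w′
          next (u′ , eq) = L.line-in (to φ (L.bottom w))
            (subst (Edge (ℤDigraph Δ k) (to φ (L.bottom w))) eq (to-edge φ (L.line-edge (symmetric u→w))))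

        induced : ∀ φ → Fixing φ → Vertex (CDHC Δ) → Vertex (CDHC Δ)
        induced φ fixed (u , s) = proj₁ (along φ fixed (both u s)) , s

        induced-place : ∀ φ fixed u s → to φ (place (u , s)) ≡ place (induced φ fixed (u , s))
        induced-place φ fixed u s = proj₂ (along φ fixed (both u s))

        -- The walks chosen for a vertex and for its image are unrelated; injectivity of `place`
        -- makes the result independent of them.
        induced-inverse : ∀ φ ψ φ-fixed ψ-fixed → (∀ q → to φ (to ψ q) ≡ q) →
                          ∀ us → induced φ φ-fixed (induced ψ ψ-fixed us) ≡ us
        induced-inverse φ ψ φ-fixed ψ-fixed φ∘ψ (u , s) = cong (_, s) (place-injective s (trans
          (sym (induced-place φ φ-fixed (proj₁ (induced ψ ψ-fixed (u , s))) s))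
          (trans (cong (to φ) (sym (induced-place ψ ψ-fixed u s))) (φ∘ψ (place (u , s))))))

        induced-edge : ∀ φ fixed us wt → Edge (CDHC Δ) us wt → Edge (CDHC Δ) (induced φ fixed us) (induced φ fixed wt)
        induced-edge φ fixed (u , 0F) (w , 1F) (refl , refl , u→w) = refl , refl ,
          L.line-edge⁻¹ (subst₂ (Edge (ℤDigraph Δ k)) (induced-place φ fixed u 0F) (induced-place φ fixed w 1F)
            (to-edge φ (L.line-edge u→w)))

        inverse-fixing : ∀ φ → Fixing φ → Fixing (inverse φ)
        inverse-fixing φ fixed = trans (cong (from φ) (sym fixed)) (from∘to φ (L.bottom c))

        induced-automorphism : ∀ φ → Fixing φ → Automorphism (CDHC Δ)
        induced-automorphism φ fixed = mkAutomorphism (induced φ fixed) (induced (inverse φ) (inverse-fixing φ fixed))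
          (induced-inverse φ (inverse φ) fixed (inverse-fixing φ fixed) (to∘from φ))
          (induced-inverse (inverse φ) φ (inverse-fixing φ fixed) fixed (from∘to φ))
          (induced-edge φ fixed) (induced-edge (inverse φ) (inverse-fixing φ fixed))

      bottom-stays : ∀ φ → to φ (L.bottom c) ≡ L.bottom c → ∀ u → ∃[ u′ ] to φ (L.bottom u) ≡ L.bottom u′
      bottom-stays φ fixed u = along φ fixed (both u 0F)

      top-fixed : Stable Δ → ∀ φ → to φ (L.bottom c) ≡ L.bottom c →
                  ∀ {u} → to φ (L.bottom u) ≡ L.bottom u → to φ (L.top u) ≡ L.top u
      top-fixed stable φ fixed {u} u-fixed = trans (induced-place φ fixed u 1F)
        (cong place (twin-fixed Δ stable (induced-automorphism φ fixed) 0F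
          (cong (_, 0F) (L.bottom-injective (trans (sym (induced-place φ fixed u 0F)) u-fixed))) 1F))

  -- Sharp k-arc-transitivity for stable symmetric digraphs

  module _ (stable : Stable Δ) (transitive : ArcTransitive 1 (CDHC Δ)) where

    private
      CDHC-arc : ∀ {x y} → Edge Δ x y → Arc 1 (CDHC Δ)
      CDHC-arc {x} {y} x→y .vertex 0F = x , 0F
      CDHC-arc {x} {y} x→y .vertex 1F = y , 1F
      CDHC-arc x→y .edge 0F = refl , refl , x→y

    twistTransitive : TwistTransitive Δ
    twistTransitive {x} {y} {x′} {y′} x→y x′→y′ =
      let g , maps = transitive (CDHC-arc x→y) (CDHC-arc x′→y′)
      in alternate (has-neighbour x→y) g ,
         cong proj₁ (maps 0F) , cong proj₁ (maps 1F)

    -- Both the absence and the presence of an odd closed walk at `x` are refuted, so it does not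
    -- have to be decided which case occurs.
    ¬arcTransitive : Branching Δ → ∀ k-1 → ¬ ArcTransitive (2 ℕ.+ k-1) (ℤDigraph Δ (ℕ.suc k-1))
    ¬arcTransitive (x , y , z , x→y , x→z , y≢z) k-1 arc-transitive = bipartite non-bipartite
      where
      open TestArcs Δ k-1 (symmetric x→y)
      open TestAutomorphism (testAutomorphism arc-transitive x→y x→z)

      -- Arc-transitivity of CDHC(Δ) gives an automorphism that fixes `(x , 0F)` and moves
      -- `(y , 1F)` to `(z , 1F)`, against `fixes-neighbours`.
      bipartite : ¬ ¬ Walk Δ x 1F x
      bipartite ¬odd = y≢z (cong proj₁ (trans
        (sym (fixes-neighbours stable (proj₁ g) (proj₂ g 0F) x→y)) (proj₂ g 1F)))
        where
        open Bipartite (has-neighbour x→y) ¬odd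
        g = transitive (CDHC-arc x→y) (CDHC-arc x→z)

      non-bipartite : ¬ Walk Δ x 1F x
      non-bipartite odd = y≢z (End.top-injective (trans (sym end-fixed) moves-last))
        where
        module StartAction = LineAction k-1 0ℤ 1ℤ refl (≡⇒≈ (ℕ.suc k-1) {0ℤ} refl) (tail 0)
        module EndAction = LineAction k-1 (+ ℕ.suc k-1) (+ ℕ.suc (ℕ.suc k-1)) (+suc (ℕ.suc k-1)) (0≈k Δ k-1) (tail (ℕ.suc k-1))

        -- The copy at the start is explored from its fixed vertex `y`, the copy at the end from
        -- `x`; an odd closed walk makes everything reachable from either.
        from-x : ∀ u → BothParities Δ x u
        from-x = odd-closed⇒bothParities odd

        from-y : ∀ u → BothParities Δ y u
        from-y u = bothParities-prepend (symmetric x→y) (from-x u)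

        start-fixed : to φ (Start.top y) ≡ Start.top y
        start-fixed = StartAction.top-fixed from-y stable φ fixes-start fixes-start

        bottom-fixed : to φ (End.bottom y) ≡ End.bottom y
        bottom-fixed = let u , eq = EndAction.bottom-stays from-x φ fixes-end y
                       in trans eq (cong End.bottom (transport φ start-fixed eq))

        end-fixed : to φ (End.top y) ≡ End.top y
        end-fixed = EndAction.top-fixed from-x stable φ fixes-end bottom-fixed

theorem11 : ∀ {v e : Level} (k : ℕ) → k ≥ 1 →
    ((∀ (n : ℕ) → n ≥ 3 → SharplyArcTransitive k (ℤDigraph (Θ n) k)) ×
    SharplyArcTransitive k (ℤDigraph Θ∞ k)) ×
    (∀ (Δ : Digraph v e) → Connected Δ → Stable Δ → Symmetric (Edge Δ) →
    ArcTransitive 1 (CDHC Δ) →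
    ArcTransitive k (ℤDigraph Δ k) ×
    (Branching Δ → SharplyArcTransitive k (ℤDigraph Δ k)))
theorem11 (ℕ.suc k-1) _ =
  ((λ n n≥3 → Θ-sharplyArcTransitive n k-1 n≥3) , Θ∞-sharplyArcTransitive k-1) ,
  λ Δ connected stable symmetric transitive →
    let k-arc-transitive = twistTransitive⇒arcTransitive Δ (ℕ.suc k-1)
                             (twistTransitive Δ connected symmetric stable transitive)
    in k-arc-transitive , λ branching →
       k-arc-transitive , ¬arcTransitive Δ connected symmetric stable transitive branching k-1
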